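{- Let $n\ge 3$ and let $G$ be any finite simple connected graph with $n$ vertices and $n$ edges. If $n$ is odd then $N(P_G)\le N(P_{C(n,n)})$, and if $n$ is even then $N(P_G)\le N(P_{C(n,n-1)})$.
   Context: For a finite simple graph $G$ on vertex set $[n]$, the symmetric edge polytope is $P_G=\operatorname{conv}\{\pm(e_i-e_j):\{i,j\}\in E(G)\}\subset\mathbb{R}^n$, where $e_i$ are the standard basis vectors; $N(P)$ denotes the number of facets of a polytope $P$. For graphs $G,H$, a wedge $G\vee H$ is a graph obtained by identifying a vertex of $G$ with a vertex of $H$. $C_m$ denotes the cycle with $m$ edges and $P_\ell$ the path with $\ell$ edges. For $3\le m\le n$, $C(n,m)$ denotes a graph on $n$ vertices obtained by wedging an $m$-cycle $C_m$ with a path with $n-m$ edges (so $C(n,n)=C_n$). -}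

module Defs where

open import Data.Bool using (Bool; true; false; _∧_; _∨_; if_then_else_)
open import Data.Nat using (ℕ; zero; suc; _∸_; _≡ᵇ_; _<ᵇ_)
open import Data.Fin using (Fin; toℕ; _≟_)
open import Data.List using (List; []; _∷_; length; filterᵇ; cartesianProduct; allFin; foldr; map)
open import Data.List.Membership.Propositional using (_∈_)
open import Data.List.Relation.Unary.Unique.Propositional using (Unique)
open import Data.Vec using (Vec; lookup)
open import Data.Rational using (ℚ; 0ℚ; 1ℚ; _+_; _-_; _*_; _≤_)
open import Data.Product using (Σ; _×_; _,_; proj₁; proj₂)
open import Relation.Binary.PropositionalEquality using (_≡_)
open import Relation.Nullary using (¬_; does)
open import Function.Bundles using (_⇔_)

-- Finite simple graphs on vertex set Fin n.
-- A graph is given by a Boolean function `lt`; only its values on pairs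
-- (i , j) with toℕ i < toℕ j matter: these say whether {i,j} is an edge.
-- Adjacency is the symmetric closure, so the graph is automatically
-- simple (symmetric, loopless, no multiple edges).

Graph : ℕ → Set
Graph n = Fin n → Fin n → Bool

Adj : ∀ {n} → Graph n → Fin n → Fin n → Bool
Adj G i j = ((toℕ i <ᵇ toℕ j) ∧ G i j) ∨ ((toℕ j <ᵇ toℕ i) ∧ G j i)

edgeCount : ∀ {n} → Graph n → ℕ
edgeCount {n} G =
  length (filterᵇ (λ p → (toℕ (proj₁ p) <ᵇ toℕ (proj₂ p)) ∧ G (proj₁ p) (proj₂ p))
                  (cartesianProduct (allFin n) (allFin n)))

data Reach {n} (G : Graph n) : Fin n → Fin n → Set where
  here  : ∀ {i} → Reach G i i
  step  : ∀ {i j k} → Adj G i j ≡ true → Reach G j k → Reach G i k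

Connected : ∀ {n} → Graph n → Set
Connected {n} G = (i j : Fin n) → Reach G i j

-- C(n,m): the m-cycle on vertices 0,…,m-1 wedged (at vertex m-1) with the
-- path m-1 — m — … — n-1 of n-m edges.  Equivalently: the path
-- 0 — 1 — … — n-1 plus the chord {0, m-1}  (m ≥ 3 assumed by users).

Cnm : (n m : ℕ) → Graph n
Cnm n m i j =
  (suc (toℕ i) ≡ᵇ toℕ j) ∨ ((toℕ i ≡ᵇ 0) ∧ ((toℕ j ≡ᵇ m ∸ 1) ∧ (1 <ᵇ toℕ j)))

-- Symmetric edge polytope P_G = conv{ e_i - e_j : i ~ j } ⊂ ℚ^n
-- (the set of generators is closed under negation since Adj is symmetric).

Point : ℕ → Set
Point n = Fin n → ℚ

δ : ∀ {n} → Fin n → Fin n → ℚ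
δ i k = if does (i ≟ k) then 1ℚ else 0ℚ

gen : ∀ {n} → Fin n → Fin n → Point n
gen i j k = δ i k - δ j k

dot : ∀ {n} → Point n → Point n → ℚ
dot {n} a x = foldr (λ k s → a k * x k + s) 0ℚ (allFin n)

-- A face of P_G is recorded by the set of generators it contains
-- (a face of a polytope is the convex hull of the generators on it,
-- so this determines the face).  Such sets are n×n Boolean matrices,
-- entry (i,j) meaning "e_i - e_j lies on the face".
GenSet : ℕ → Set
GenSet n = Vec (Vec Bool n) n

_∋ₛ_,_ : ∀ {n} → GenSet n → Fin n → Fin n → Bool
S ∋ₛ i , j = lookup (lookup S i) j

IsFace : ∀ {n} → Graph n → GenSet n → Set
IsFace {n} G S = Σ (Point n) λ a → Σ ℚ λ b →
  ((i j : Fin n) → Adj G i j ≡ true → dot a (gen i j) ≤ b) ×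
  ((i j : Fin n) → ((S ∋ₛ i , j) ≡ true) ⇔ ((Adj G i j ≡ true) × (dot a (gen i j) ≡ b)))

IsProper : ∀ {n} → Graph n → GenSet n → Set
IsProper {n} G S = ¬ ((i j : Fin n) → Adj G i j ≡ true → (S ∋ₛ i , j) ≡ true)

_⊆ₛ_ : ∀ {n} → GenSet n → GenSet n → Set
_⊆ₛ_ {n} S T = (i j : Fin n) → (S ∋ₛ i , j) ≡ true → (T ∋ₛ i , j) ≡ true

IsFacet : ∀ {n} → Graph n → GenSet n → Set
IsFacet G S = IsFace G S × IsProper G S ×
  (∀ T → IsFace G T → IsProper G T → S ⊆ₛ T → T ≡ S)

FacetCount : ∀ {n} → Graph n → ℕ → Set
FacetCount {n} G k = Σ (List (GenSet n)) λ L →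
  Unique L × ((S : GenSet n) → (S ∈ L) ⇔ IsFacet G S) × (length L ≡ k)

{-# OPTIONS --safe #-}
module Submission where

-- A face of P_G is cut out by a potential a on the vertices with |a_i - a_j| ≤ b along edges.
-- For a connected graph with n vertices and n edges, i.e. with a single cycle, the edge
-- differences are exactly the vectors summing to zero around the cycle.  A facet admits no
-- perturbation that keeps its tight edges and creates a new one, so every edge off the cycle is
-- tight and at most one cycle edge is slack; integrality then makes that edge's difference 0.
-- Hence the facets correspond to sign words, balanced on the cycle, with at most one zero there.
-- For a cycle of length m = 2k + z, z ≤ 1, there are 2^(n-m) g(m) of them, g(m) = m! / (k! k!).
-- Now 4 g(2k+1) ≤ g(2k+3) and g(2k+2) ≤ 2 g(2k+1) show that m = n (n odd), respectively
-- m = n - 1 (n even), is optimal.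

open import Defs

-- Why one slack edge helps: on a cycle of length 2k + 1 it can stand at any of 2k + 1 places before
-- the remaining 2k signs are balanced, while an even cycle admits no slack edge. Lengthening an odd
-- cycle by two just beats the factor 4 that two pendant edges would give.
--
-- The integrality step: with p edges at b, q edges at -b and a slack value x, the cycle condition
-- reads (p - q) b + x = 0 with |x| < b, which forces p = q and then x = 0. So the parity of the
-- cycle length decides whether a slack edge occurs.
--
-- A facet count is only given as a duplicate-free list of Boolean matrices. It is therefore never
-- computed but compared with explicit lists of words through a matching, and each graph needs one
-- direction: facets go injectively to words for G, words to facets for C(n,m). Both graphs enter
-- through the same interface `Presentation`; for G it comes from a spanning tree and the one edge
-- outside it, for C(n,m) from the path and its chord.

module Counting where

  open import Data.Bool using (Bool; true; false)
  open import Data.Empty using (⊥; ⊥-elim)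
  open import Data.List using (List; []; _∷_; _++_; length; map)
  open import Data.List.Membership.Propositional using (_∈_)
  open import Data.List.Membership.Propositional.Properties using (∈-∃++; ∈-++⁺ˡ; ∈-++⁺ʳ; ∈-++⁻; ∈-map⁺; ∈-map⁻)
  open import Data.List.Properties using (length-++; length-map)
  import Data.List.Relation.Unary.All as All
  open import Data.List.Relation.Unary.AllPairs using ([]; _∷_)
  open import Data.List.Relation.Unary.Any using (here; there)
  open import Data.List.Relation.Unary.Unique.Propositional using (Unique)
  import Data.List.Relation.Unary.Unique.Propositional.Properties as Unique
  open import Data.Nat using (ℕ; zero; suc; _+_; _*_; _^_; _≤_; z≤n; s≤s; _!; _%_; NonZero)
  open import Data.Nat.Properties
  open import Data.Nat.Solver using (module +-*-Solver)
  open import Data.Product using (∃; _×_; _,_)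
  open import Data.Sum using (inj₁; inj₂)
  open import Data.Vec using (Vec; []; _∷_; replicate)
  open import Relation.Binary.PropositionalEquality using (_≡_; _≢_; refl; sym; trans; cong; cong₂; subst; module ≡-Reasoning)

  -- Each step deletes the partner of `x` from `ys`. No later element loses its own partner in this
  -- way, since injectivity would identify it with `x`, against uniqueness. With a relation in place
  -- of a function, one matching between facets and words serves in both directions.
  length-≤-injective : ∀ {A B : Set} (R : A → B → Set) →
    (∀ {x y z} → R x z → R y z → x ≡ y) → ∀ {xs ys} → Unique xs →
    (∀ {x} → x ∈ xs → ∃ λ y → y ∈ ys × R x y) → length xs ≤ length ys
  length-≤-injective R inj {[]} u tot = z≤n
  length-≤-injective R inj {x ∷ xs} (x∉ ∷ u) tot
    with tot (here refl)
  ... | y , y∈ , Rxy with ∈-∃++ y∈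
  ... | as , bs , refl = subst (suc (length xs) ≤_) (sym len)
          (s≤s (length-≤-injective R inj u tot′))
    where
    len : length (as ++ y ∷ bs) ≡ suc (length (as ++ bs))
    len = trans (length-++ as) (trans (+-suc (length as) (length bs)) (cong suc (sym (length-++ as))))
    tot′ : ∀ {x′} → x′ ∈ xs → ∃ λ y′ → y′ ∈ as ++ bs × R x′ y′
    tot′ x′∈ with tot (there x′∈)
    ... | y′ , y′∈ , Rx′y′ with ∈-++⁻ as y′∈
    ... | inj₁ p = y′ , ∈-++⁺ˡ p , Rx′y′
    ... | inj₂ (there p) = y′ , ∈-++⁺ʳ as p , Rx′y′
    ... | inj₂ (here refl) = ⊥-elim (All.lookup x∉ x′∈ (inj Rxy Rx′y′))

  -- Sign words and their enumeration

  data Sgn : Set where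
    plus null minus : Sgn

  -- The edges marked in c form the cycle.  A sign records how a generator pair ±(e_i - e_j) meets
  -- a facet (null: neither lies on it); p, q and z count the plus, minus and null cycle edges.
  data Word : ∀ {M} → Vec Bool M → Vec Sgn M → (p q z : ℕ) → Set where
    []    : Word [] [] 0 0 0
    free₊ : ∀ {M} {c : Vec Bool M} {w p q z} → Word c w p q z → Word (false ∷ c) (plus ∷ w) p q z
    free₋ : ∀ {M} {c : Vec Bool M} {w p q z} → Word c w p q z → Word (false ∷ c) (minus ∷ w) p q z
    cyc₊  : ∀ {M} {c : Vec Bool M} {w p q z} → Word c w p q z → Word (true ∷ c) (plus ∷ w) (suc p) q z
    cyc₋  : ∀ {M} {c : Vec Bool M} {w p q z} → Word c w p q z → Word (true ∷ c) (minus ∷ w) p (suc q) z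
    cyc₀  : ∀ {M} {c : Vec Bool M} {w p q z} → Word c w p q z → Word (true ∷ c) (null ∷ w) p q (suc z)

  -- Spends one unit of a quota: the numerical argument says how often `s` must still occur, so at
  -- zero this branch is empty.
  prepend : ∀ {M} → Sgn → (ℕ → List (Vec Sgn M)) → ℕ → List (Vec Sgn (suc M))
  prepend s f zero    = []
  prepend s f (suc n) = map (s ∷_) (f n)

  words : ∀ {M} → Vec Bool M → (p q z : ℕ) → List (Vec Sgn M)
  words [] zero zero zero = [] ∷ []
  words [] _    _    _    = []
  words (false ∷ c) p q z = map (plus ∷_) (words c p q z) ++ map (minus ∷_) (words c p q z)
  words (true ∷ c)  p q z =
    prepend plus  (λ p′ → words c p′ q z) p ++
    prepend minus (λ q′ → words c p q′ z) q ++
    prepend null  (λ z′ → words c p q z′) z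

  ∈-prepend⁻ : ∀ {M} s (f : ℕ → List (Vec Sgn M)) n {v} → v ∈ prepend s f n →
    ∃ λ k → ∃ λ u → n ≡ suc k × u ∈ f k × v ≡ s ∷ u
  ∈-prepend⁻ s f (suc n) v∈ with ∈-map⁻ _ v∈
  ... | u , u∈ , refl = n , u , refl , u∈ , refl

  word⇒∈words : ∀ {M} {c : Vec Bool M} {w p q z} → Word c w p q z → w ∈ words c p q z
  word⇒∈words [] = here refl
  word⇒∈words (free₊ W) = ∈-++⁺ˡ (∈-map⁺ _ (word⇒∈words W))
  word⇒∈words (free₋ W) = ∈-++⁺ʳ _ (∈-map⁺ _ (word⇒∈words W))
  word⇒∈words (cyc₊ W) = ∈-++⁺ˡ (∈-map⁺ _ (word⇒∈words W))
  word⇒∈words {p = p} (cyc₋ W) =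
    ∈-++⁺ʳ (prepend plus _ p) (∈-++⁺ˡ (∈-map⁺ _ (word⇒∈words W)))
  word⇒∈words {p = p} {q = q} (cyc₀ W) =
    ∈-++⁺ʳ (prepend plus _ p) (∈-++⁺ʳ (prepend minus _ q) (∈-map⁺ _ (word⇒∈words W)))

  ∈words⇒word : ∀ {M} (c : Vec Bool M) {w} p q z → w ∈ words c p q z → Word c w p q z
  ∈words⇒word [] zero zero zero (here refl) = []
  ∈words⇒word [] zero zero (suc z) ()
  ∈words⇒word [] zero (suc q) z ()
  ∈words⇒word [] (suc p) q z ()
  ∈words⇒word (false ∷ c) p q z w∈ with ∈-++⁻ (map (plus ∷_) (words c p q z)) w∈
  ... | inj₁ i with ∈-map⁻ _ i
  ... | _ , u∈ , refl = free₊ (∈words⇒word c p q z u∈)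
  ∈words⇒word (false ∷ c) p q z w∈ | inj₂ i with ∈-map⁻ _ i
  ... | _ , u∈ , refl = free₋ (∈words⇒word c p q z u∈)
  ∈words⇒word (true ∷ c) p q z w∈ with ∈-++⁻ (prepend plus _ p) w∈
  ... | inj₁ i with ∈-prepend⁻ plus _ p i
  ... | k , _ , refl , u∈ , refl = cyc₊ (∈words⇒word c k q z u∈)
  ∈words⇒word (true ∷ c) p q z w∈ | inj₂ j with ∈-++⁻ (prepend minus _ q) j
  ... | inj₁ i with ∈-prepend⁻ minus _ q i
  ... | k , _ , refl , u∈ , refl = cyc₋ (∈words⇒word c p k z u∈)
  ∈words⇒word (true ∷ c) p q z w∈ | inj₂ j | inj₂ i with ∈-prepend⁻ null _ z i
  ... | k , _ , refl , u∈ , refl = cyc₀ (∈words⇒word c p q k u∈)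

  prepend-unique : ∀ {M} s {f : ℕ → List (Vec Sgn M)} → (∀ k → Unique (f k)) →
    ∀ n → Unique (prepend s f n)
  prepend-unique s uf zero    = []
  prepend-unique s uf (suc n) = Unique.map⁺ (λ { refl → refl }) (uf n)

  words-unique : ∀ {M} (c : Vec Bool M) p q z → Unique (words c p q z)
  words-unique [] zero    zero    zero    = All.[] ∷ []
  words-unique [] zero    zero    (suc z) = []
  words-unique [] zero    (suc q) z       = []
  words-unique [] (suc p) q       z       = []
  words-unique (false ∷ c) p q z =
    Unique.++⁺ (Unique.map⁺ (λ { refl → refl }) u) (Unique.map⁺ (λ { refl → refl }) u) disjoint
    where
    u = words-unique c p q z
    disjoint : ∀ {v} → v ∈ map (plus ∷_) (words c p q z) × v ∈ map (minus ∷_) (words c p q z) → ⊥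
    disjoint (i , j) with ∈-map⁻ _ i | ∈-map⁻ _ j
    ... | _ , _ , refl | _ , _ , ()
  words-unique (true ∷ c) p q z =
    Unique.++⁺ (prepend-unique plus (λ k → words-unique c k q z) p)
      (Unique.++⁺ (prepend-unique minus (λ k → words-unique c p k z) q)
        (prepend-unique null (λ k → words-unique c p q k) z) disjoint₂) disjoint₁
    where
    disjoint₂ : ∀ {v} → v ∈ prepend minus (λ k → words c p k z) q ×
                        v ∈ prepend null (words c p q) z → ⊥
    disjoint₂ (i , j) with ∈-prepend⁻ minus _ q i | ∈-prepend⁻ null _ z j
    ... | _ , _ , _ , _ , refl | _ , _ , _ , _ , ()
    disjoint₁ : ∀ {v} → v ∈ prepend plus (λ k → words c k q z) p ×
                        v ∈ prepend minus (λ k → words c p k z) q ++ prepend null (words c p q) z → ⊥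
    disjoint₁ (i , j) with ∈-prepend⁻ plus _ p i | ∈-++⁻ (prepend minus _ q) j
    ... | _ , _ , _ , _ , refl | inj₁ k with ∈-prepend⁻ minus _ q k
    ... | _ , _ , _ , _ , ()
    disjoint₁ (i , j) | _ , _ , _ , _ , refl | inj₂ k with ∈-prepend⁻ null _ z k
    ... | _ , _ , _ , _ , ()

  -- Multinomial count of the words and its growth

  trues falses : ∀ {M} → Vec Bool M → ℕ
  trues []          = 0
  trues (true ∷ c)  = suc (trues c)
  trues (false ∷ c) = trues c
  falses []          = 0
  falses (true ∷ c)  = falses c
  falses (false ∷ c) = suc (falses c)

  trues+falses : ∀ {M} (c : Vec Bool M) → falses c + trues c ≡ M
  trues+falses []          = refl
  trues+falses (true ∷ c)  = trans (+-suc (falses c) (trues c)) (cong suc (trues+falses c))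
  trues+falses (false ∷ c) = cong suc (trues+falses c)

  word-size : ∀ {M} {c : Vec Bool M} {w p q z} → Word c w p q z → p + q + z ≡ trues c
  word-size [] = refl
  word-size (free₊ W) = word-size W
  word-size (free₋ W) = word-size W
  word-size (cyc₊ W) = cong suc (word-size W)
  word-size (cyc₋ {p = p} {q} {z} W) = trans (cong (_+ z) (+-suc p q)) (cong suc (word-size W))
  word-size (cyc₀ {p = p} {q} {z} W) = trans (+-suc (p + q) z) (cong suc (word-size W))

  -- One of the three summands of (p + q + z) K in the multinomial recursion, K being the common
  -- value after one letter is removed. In multiplied form an exhausted quota contributes 0 on both
  -- sides, so `h` is asked for successors only.
  length-prepend : ∀ {M} s (f : ℕ → List (Vec Sgn M)) n X K →
    (∀ k → n ≡ suc k → length (f k) * (k ! * X) ≡ K) →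
    length (prepend s f n) * (n ! * X) ≡ n * K
  length-prepend s f zero    X K h = refl
  length-prepend s f (suc n) X K h = begin
    length (map (s ∷_) (f n)) * ((suc n * n !) * X)
      ≡⟨ cong (_* ((suc n * n !) * X)) (length-map (s ∷_) (f n)) ⟩
    length (f n) * ((suc n * n !) * X)
      ≡⟨ solve 4 (λ l t r x → l :* ((t :* r) :* x) := t :* (l :* (r :* x))) refl
           (length (f n)) (suc n) (n !) X ⟩
    suc n * (length (f n) * (n ! * X))
      ≡⟨ cong (suc n *_) (h n refl) ⟩
    suc n * K ∎
    where
    open ≡-Reasoning
    open +-*-Solver

  -- On the support the words are arrangements of a multiset, hence the multinomial count.
  length-words : ∀ {M} (c : Vec Bool M) p q z → p + q + z ≡ trues c →
    length (words c p q z) * (p ! * q ! * z !) ≡ 2 ^ falses c * trues c !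
  length-words [] zero zero zero eq = refl
  length-words (false ∷ c) p q z eq = begin
    length (map (plus ∷_) ws ++ map (minus ∷_) ws) * X
      ≡⟨ cong (_* X) (length-++ (map (plus ∷_) ws)) ⟩
    (length (map (plus ∷_) ws) + length (map (minus ∷_) ws)) * X
      ≡⟨ cong (_* X) (cong₂ _+_ (length-map (plus ∷_) ws) (length-map (minus ∷_) ws)) ⟩
    (length ws + length ws) * X
      ≡⟨ solve 2 (λ l x → (l :+ l) :* x := con 2 :* (l :* x)) refl (length ws) X ⟩
    2 * (length ws * X)
      ≡⟨ cong (2 *_) (length-words c p q z eq) ⟩
    2 * (2 ^ falses c * trues c !)
      ≡⟨ sym (*-assoc 2 (2 ^ falses c) (trues c !)) ⟩
    2 * 2 ^ falses c * trues c ! ∎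
    where
    open ≡-Reasoning
    open +-*-Solver
    ws = words c p q z
    X = p ! * q ! * z !
  length-words (true ∷ c) p q z eq = begin
    length (as ++ bs ++ cs) * (P * Q * Z)
      ≡⟨ cong (_* (P * Q * Z)) (trans (length-++ as) (cong (length as +_) (length-++ bs))) ⟩
    (length as + (length bs + length cs)) * (P * Q * Z)
      ≡⟨ solve 6 (λ a b d P Q Z → (a :+ (b :+ d)) :* (P :* Q :* Z) :=
           a :* (P :* (Q :* Z)) :+ b :* (Q :* (P :* Z)) :+ d :* (Z :* (P :* Q))) refl
           (length as) (length bs) (length cs) P Q Z ⟩
    length as * (P * (Q * Z)) + length bs * (Q * (P * Z)) + length cs * (Z * (P * Q))
      ≡⟨ cong₂ _+_ (cong₂ _+_
           (length-prepend plus _ p (Q * Z) K λ { k refl →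
             trans (cong (length (words c k q z) *_) (sym (*-assoc (k !) Q Z)))
                   (length-words c k q z (suc-injective eq)) })
           (length-prepend minus _ q (P * Z) K λ { k refl →
             trans (cong (length (words c p k z) *_)
                     (solve 3 (λ k P Z → k :* (P :* Z) := P :* k :* Z) refl (k !) P Z))
                   (length-words c p k z
                     (suc-injective (trans (cong (_+ z) (sym (+-suc p k))) eq))) }))
           (length-prepend null _ z (P * Q) K λ { k refl →
             trans (cong (length (words c p q k) *_) (*-comm (k !) (P * Q)))
                   (length-words c p q k (suc-injective (trans (sym (+-suc (p + q) k)) eq))) }) ⟩
    p * K + q * K + z * K
      ≡⟨ solve 4 (λ p q z K → p :* K :+ q :* K :+ z :* K := (p :+ q :+ z) :* K) refl p q z K ⟩
    (p + q + z) * K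
      ≡⟨ cong (_* K) eq ⟩
    suc (trues c) * (2 ^ falses c * trues c !)
      ≡⟨ solve 3 (λ t f m → t :* (f :* m) := f :* (t :* m)) refl
           (suc (trues c)) (2 ^ falses c) (trues c !) ⟩
    2 ^ falses c * (suc (trues c) * trues c !) ∎
    where
    open ≡-Reasoning
    open +-*-Solver
    P = p !
    Q = q !
    Z = z !
    K = 2 ^ falses c * trues c !
    as = prepend plus (λ p′ → words c p′ q z) p
    bs = prepend minus (λ q′ → words c p q′ z) q
    cs = prepend null (λ z′ → words c p q z′) z

  trues-replicate : ∀ n → trues (replicate n true) ≡ n
  trues-replicate zero    = refl
  trues-replicate (suc n) = cong suc (trues-replicate n)

  falses-replicate : ∀ n → falses (replicate n true) ≡ 0
  falses-replicate zero    = refl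
  falses-replicate (suc n) = falses-replicate n

  -- The number of facets for a cycle of length k + k + z, where z ≤ 1.
  cycleCount : (k z : ℕ) → ℕ
  cycleCount k z = length (words (replicate (k + k + z) true) k k z)

  -- The quotient m! / (k! k!) in multiplied form; the comparisons below cancel the positive factor
  -- and never divide.
  cycleCount-! : ∀ k z → cycleCount k z * (k ! * k ! * z !) ≡ (k + k + z) !
  cycleCount-! k z = begin
    cycleCount k z * (k ! * k ! * z !)
      ≡⟨ length-words (replicate m true) k k z (sym (trues-replicate m)) ⟩
    2 ^ falses (replicate m true) * trues (replicate m true) !
      ≡⟨ cong₂ (λ f t → 2 ^ f * t !) (falses-replicate m) (trues-replicate m) ⟩
    1 * m !
      ≡⟨ *-identityˡ (m !) ⟩
    m ! ∎
    where
    open ≡-Reasoning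
    m = k + k + z

  denominator≢0 : ∀ k z → NonZero (k ! * k ! * z !)
  denominator≢0 k z = m*n≢0 (k ! * k !) (z !) {{m*n≢0 (k !) (k !) {{k !≢0}} {{k !≢0}}}} {{z !≢0}}

  -- After multiplication by the factorials both sides are values of `length-words`, which sees `c`
  -- only through its numbers of marked and unmarked edges.
  length-words-cycleCount : ∀ {M} (c : Vec Bool M) k z → k + k + z ≡ trues c →
    length (words c k k z) ≡ 2 ^ falses c * cycleCount k z
  length-words-cycleCount c k z eq = *-cancelʳ-≡ _ _ X {{denominator≢0 k z}} (begin
    length (words c k k z) * X         ≡⟨ length-words c k k z eq ⟩
    2 ^ falses c * trues c !           ≡⟨ cong (λ t → 2 ^ falses c * t !) (sym eq) ⟩
    2 ^ falses c * (k + k + z) !       ≡⟨ cong (2 ^ falses c *_) (sym (cycleCount-! k z)) ⟩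
    2 ^ falses c * (cycleCount k z * X) ≡⟨ sym (*-assoc (2 ^ falses c) (cycleCount k z) X) ⟩
    2 ^ falses c * cycleCount k z * X  ∎)
    where
    open ≡-Reasoning
    X = k ! * k ! * z !

  -- The quotient g(2k+3) / g(2k+1) equals (2k+3)(2k+2) / (k+1)^2 = 4 + 2/(k+1).
  cycleCount-odd-step : ∀ k → 2 * (2 * cycleCount k 1) ≤ cycleCount (suc k) 1
  cycleCount-odd-step k = *-cancelʳ-≤ _ _ X {{denominator≢0 (suc k) 1}} (begin
    2 * (2 * C) * (s * r * (s * r) * 1)
      ≡⟨ solve 3 (λ C s r → con 2 :* (con 2 :* C) :* (s :* r :* (s :* r) :* con 1)
           := con 4 :* (s :* s) :* (C :* (r :* r :* con 1))) refl C s r ⟩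
    4 * (s * s) * (C * (r * r * 1))
      ≡⟨ cong (4 * (s * s) *_) (cycleCount-! k 1) ⟩
    4 * (s * s) * F
      -- Since s = k + 1, the product (2k+3)(2k+2) is 4 s^2 + 2 s, and 2 s is the surplus.
      ≤⟨ *-monoˡ-≤ F (m≤m+n (4 * (s * s)) (2 * s)) ⟩
    (4 * (s * s) + 2 * s) * F
      ≡⟨ solve 2 (λ k F → (con 4 :* ((con 1 :+ k) :* (con 1 :+ k)) :+ con 2 :* (con 1 :+ k)) :* F
           := (con 2 :+ (k :+ k :+ con 1)) :* ((con 1 :+ (k :+ k :+ con 1)) :* F)) refl k F ⟩
    (2 + (k + k + 1)) !
      ≡⟨ cong _! (solve 1 (λ k → con 2 :+ (k :+ k :+ con 1)
           := (con 1 :+ k) :+ (con 1 :+ k) :+ con 1) refl k) ⟩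
    (suc k + suc k + 1) !
      ≡⟨ sym (cycleCount-! (suc k) 1) ⟩
    cycleCount (suc k) 1 * X ∎)
    where
    open ≤-Reasoning
    open +-*-Solver
    X = suc k ! * suc k ! * 1 !
    C = cycleCount k 1
    s = suc k
    r = k !
    F = (k + k + 1) !

  -- The quotient g(2k+2) / g(2k+1) is (2k+2) / (k+1)^2 = 2/(k+1): the loss of the slack edge costs
  -- more than the extra sign gains once k > 1.
  cycleCount-even≤odd : ∀ k → cycleCount (suc k) 0 ≤ 2 * cycleCount k 1
  cycleCount-even≤odd k = *-cancelʳ-≤ _ _ X {{denominator≢0 (suc k) 0}} (begin
    cycleCount (suc k) 0 * X
      ≡⟨ cycleCount-! (suc k) 0 ⟩
    (suc k + suc k + 0) !
      ≡⟨ cong _! (solve 1 (λ k → (con 1 :+ k) :+ (con 1 :+ k) :+ con 0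
           := con 1 :+ (k :+ k :+ con 1)) refl k) ⟩
    (1 + (k + k + 1)) * F
      -- The left factor is 2 s, the target 2 s^2, and their difference 2 k s.
      ≤⟨ *-monoˡ-≤ F (m≤m+n (1 + (k + k + 1)) (2 * (k * s))) ⟩
    (1 + (k + k + 1) + 2 * (k * s)) * F
      ≡⟨ cong (_* F) (solve 1 (λ k → con 1 :+ (k :+ k :+ con 1) :+ con 2 :* (k :* (con 1 :+ k))
           := con 2 :* ((con 1 :+ k) :* (con 1 :+ k))) refl k) ⟩
    2 * (s * s) * F
      ≡⟨ cong (2 * (s * s) *_) (sym (cycleCount-! k 1)) ⟩
    2 * (s * s) * (C * (r * r * 1))
      ≡⟨ solve 3 (λ C s r → con 2 :* (s :* s) :* (C :* (r :* r :* con 1))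
           := con 2 :* C :* (s :* r :* (s :* r) :* con 1)) refl C s r ⟩
    2 * C * X ∎)
    where
    open ≤-Reasoning
    open +-*-Solver
    X = suc k ! * suc k ! * 0 !
    C = cycleCount k 1
    s = suc k
    r = k !
    F = (k + k + 1) !

  -- Parity and the maximal count

  double : ℕ → ℕ
  double zero    = zero
  double (suc k) = suc (suc (double k))

  double≡+ : ∀ k → double k ≡ k + k
  double≡+ zero    = refl
  double≡+ (suc k) = cong suc (trans (cong suc (double≡+ k)) (sym (+-suc k k)))

  double-injective : ∀ {j k} → double j ≡ double k → j ≡ k
  double-injective {zero}  {zero}  eq = refl
  double-injective {suc j} {suc k} eq = cong suc (double-injective (suc-injective (suc-injective eq)))

  double≢suc-double : ∀ {j k} → double j ≢ suc (double k)
  double≢suc-double {suc j} {suc k} eq = double≢suc-double {j} {k} (suc-injective (suc-injective eq))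

  double%2 : ∀ k → double k % 2 ≡ 0
  double%2 zero    = refl
  double%2 (suc k) = double%2 k

  suc-double%2 : ∀ k → suc (double k) % 2 ≡ 1
  suc-double%2 zero    = refl
  suc-double%2 (suc k) = suc-double%2 k

  data Parity : ℕ → Set where
    even : ∀ k → Parity (double k)
    odd  : ∀ k → Parity (suc (double k))

  next : ∀ {n} → Parity n → Parity (suc n)
  next (even k) = odd k
  next (odd k)  = even (suc k)

  parity : ∀ n → Parity n
  parity zero    = even zero
  parity (suc n) = next (parity n)

  parityCount : ∀ {m} → Parity m → ℕ
  parityCount (even k) = cycleCount k 0
  parityCount (odd k)  = cycleCount k 1

  -- No unicyclic graph has 0 vertices; there the value is junk.
  maxCount : ∀ {n} → Parity n → ℕ
  maxCount (even zero)    = 0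
  maxCount (even (suc k)) = 2 * cycleCount k 1
  maxCount (odd k)        = cycleCount k 1

  -- A further vertex at least doubles the maximum. From odd to even it is a pendant edge, with
  -- equality; from even to odd that pendant edge and the new vertex together lengthen the cycle by
  -- two, which is the factor 4 of `cycleCount-odd-step`.
  maxCount-next : ∀ {n} (P : Parity n) → 2 * maxCount P ≤ maxCount (next P)
  maxCount-next (even zero)    = z≤n
  maxCount-next (even (suc k)) = cycleCount-odd-step k
  maxCount-next (odd k)        = ≤-refl

  parityCount≤maxCount : ∀ {m} (P : Parity m) → 1 ≤ m → parityCount P ≤ maxCount P
  parityCount≤maxCount (even (suc k)) 1≤m = cycleCount-even≤odd k
  parityCount≤maxCount (odd k)        1≤m = ≤-refl

  -- Induction on the number of edges off the cycle: each one doubles the left side exactly and the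
  -- right side at least.
  2^*parityCount≤maxCount : ∀ f m → 1 ≤ m → 2 ^ f * parityCount (parity m) ≤ maxCount (parity (f + m))
  2^*parityCount≤maxCount zero    m 1≤m =
    ≤-trans (≤-reflexive (*-identityˡ _)) (parityCount≤maxCount (parity m) 1≤m)
  2^*parityCount≤maxCount (suc f) m 1≤m = begin
    2 * 2 ^ f * parityCount (parity m)   ≡⟨ *-assoc 2 (2 ^ f) _ ⟩
    2 * (2 ^ f * parityCount (parity m)) ≤⟨ *-monoʳ-≤ 2 (2^*parityCount≤maxCount f m 1≤m) ⟩
    2 * maxCount (parity (f + m))        ≤⟨ maxCount-next (parity (f + m)) ⟩
    maxCount (parity (suc f + m))        ∎
    where open ≤-Reasoning

module Polytopes where

  open Counting
  open import Data.Rational using (ℚ; 0ℚ; 1ℚ; _+_; _-_; _*_; -_; _≤_; _<_; +-0-rawMonoid)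
  open import Data.Rational.Properties
  open import Algebra.Definitions.RawMonoid +-0-rawMonoid using () renaming (_×_ to _·_)
  open import Algebra.Properties.Group +-0-group using () renaming (∙-cancelˡ to +-cancelˡ)
  open import Data.Bool using (Bool; true; false; _∧_; _∨_; if_then_else_)
  open import Data.Bool.Properties using (T-≡; T?; ∨-comm; ∨-identityʳ; ∨-zeroʳ)
  open import Data.Empty using (⊥; ⊥-elim)
  open import Data.Fin using (Fin; zero; suc; toℕ; inject₁; fromℕ)
  import Data.Fin.Properties as Fin
  open import Data.List using (List; []; _∷_; length; foldr; tabulate; allFin; cartesianProduct; filterᵇ)
  import Data.List.Membership.DecPropositional as DecMembership
  open import Data.List.Membership.Propositional using (_∈_; _∉_; find; lose)
  open import Data.List.Membership.Propositional.Properties using (∈-allFin; ∈-filter⁺; ∈-filter⁻; ∈-cartesianProduct⁺)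
  open import Data.List.Properties using (length-tabulate)
  open import Data.List.Relation.Unary.All using ([]; _∷_)
  import Data.List.Relation.Unary.All as All
  open import Data.List.Relation.Unary.AllPairs using ([]; _∷_)
  open import Data.List.Relation.Unary.Any using (here; there; any?)
  open import Data.List.Relation.Unary.Unique.Propositional using (Unique)
  import Data.List.Relation.Unary.Unique.Propositional.Properties as Unique
  open import Data.Nat using (ℕ; zero; suc; s≤s; z≤n; _∸_; _%_; _<ᵇ_; _≡ᵇ_)
  import Data.Nat as ℕ
  import Data.Nat.Properties as ℕ
  open import Data.Product using (∃; ∃₂; _×_; _,_; proj₁; proj₂; swap)
  open import Data.Product.Properties using (≡-dec)
  open import Data.Rational.Solver using (module +-*-Solver)
  open import Data.Sum using (_⊎_; inj₁; inj₂)
  import Data.Sum as Sum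
  open import Data.Unit using (⊤; tt)
  open import Data.Vec using (Vec; []; _∷_; lookup; replicate)
  import Data.Vec as Vec
  open import Data.Vec.Functional using (updateAt)
  open import Data.Vec.Functional.Properties using (updateAt-updates; updateAt-minimal)
  open import Data.Vec.Properties using (tabulate-cong; tabulate∘lookup; lookup∘tabulate)
  open import Function using (_∘_; id; const; _⇔_; mk⇔; Equivalence)
  open import Function.Construct.Composition using (_⇔-∘_)
  open import Relation.Binary using (tri<; tri≈; tri>)
  open import Relation.Binary.PropositionalEquality using (_≡_; _≢_; refl; sym; trans; cong; cong₂; subst; subst₂; module ≡-Reasoning)
  open import Relation.Nullary using (yes; no; does; ¬?)
  open import Relation.Nullary.Decidable using (dec-true; decidable-stable)
  open +-*-Solver using (solve; _:=_; _:+_; _:-_; _:*_; :-_; con)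
  open Equivalence using (to; from)

  -- Functionals on generators as potential differences

  sumFin : ∀ {n} → (Fin n → ℚ) → ℚ
  sumFin {zero}  h = 0ℚ
  sumFin {suc n} h = h zero + sumFin (h ∘ suc)

  -- General in `f` for the induction, because the tail of `tabulate f` is `tabulate (f ∘ suc)`.
  foldr-tabulate : ∀ {m n} (h : Fin m → ℚ) (f : Fin n → Fin m) →
    foldr (λ k s → h k + s) 0ℚ (tabulate f) ≡ sumFin (h ∘ f)
  foldr-tabulate {n = zero}  h f = refl
  foldr-tabulate {n = suc n} h f = cong (h (f zero) +_) (foldr-tabulate h (f ∘ suc))

  sumFin-0 : ∀ {n} (a : Point n) → sumFin (λ k → a k * (0ℚ - 0ℚ)) ≡ 0ℚ
  sumFin-0 {zero}  a = refl
  sumFin-0 {suc n} a = trans (cong₂ _+_ (*-zeroʳ (a zero)) (sumFin-0 (a ∘ suc))) refl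

  sumFin-δˡ : ∀ {n} (a : Point n) i → sumFin (λ k → a k * (δ i k - 0ℚ)) ≡ a i
  sumFin-δˡ a zero    = trans (cong (a zero * (1ℚ - 0ℚ) +_) (sumFin-0 (a ∘ suc)))
    (solve 1 (λ x → x :* (con 1ℚ :- con 0ℚ) :+ con 0ℚ := x) refl (a zero))
  sumFin-δˡ a (suc i) = trans (cong (a zero * (0ℚ - 0ℚ) +_) (sumFin-δˡ (a ∘ suc) i))
    (solve 2 (λ x y → x :* (con 0ℚ :- con 0ℚ) :+ y := y) refl (a zero) (a (suc i)))

  sumFin-δʳ : ∀ {n} (a : Point n) j → sumFin (λ k → a k * (0ℚ - δ j k)) ≡ - a j
  sumFin-δʳ a zero    = trans (cong (a zero * (0ℚ - 1ℚ) +_) (sumFin-0 (a ∘ suc)))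
    (solve 1 (λ x → x :* (con 0ℚ :- con 1ℚ) :+ con 0ℚ := :- x) refl (a zero))
  sumFin-δʳ a (suc j) = trans (cong (a zero * (0ℚ - 0ℚ) +_) (sumFin-δʳ (a ∘ suc) j))
    (solve 2 (λ x y → x :* (con 0ℚ :- con 0ℚ) :+ :- y := :- y) refl (a zero) (a (suc j)))

  sumFin-gen : ∀ {n} (a : Point n) i j → sumFin (λ k → a k * gen i j k) ≡ a i - a j
  sumFin-gen a zero zero = trans (cong (a zero * (1ℚ - 1ℚ) +_) (sumFin-0 (a ∘ suc)))
    (solve 1 (λ x → x :* (con 1ℚ :- con 1ℚ) :+ con 0ℚ := x :- x) refl (a zero))
  sumFin-gen a zero (suc j) = trans (cong (a zero * (1ℚ - 0ℚ) +_) (sumFin-δʳ (a ∘ suc) j))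
    (solve 2 (λ x y → x :* (con 1ℚ :- con 0ℚ) :+ :- y := x :- y) refl (a zero) (a (suc j)))
  sumFin-gen a (suc i) zero = trans (cong (a zero * (0ℚ - 1ℚ) +_) (sumFin-δˡ (a ∘ suc) i))
    (solve 2 (λ x y → x :* (con 0ℚ :- con 1ℚ) :+ y := y :- x) refl (a zero) (a (suc i)))
  sumFin-gen a (suc i) (suc j) = trans (cong (a zero * (0ℚ - 0ℚ) +_) (sumFin-gen (a ∘ suc) i j))
    (solve 3 (λ x y z → x :* (con 0ℚ :- con 0ℚ) :+ (y :- z) := y :- z) refl
       (a zero) (a (suc i)) (a (suc j)))

  dot-gen : ∀ {n} (a : Point n) i j → dot a (gen i j) ≡ a i - a j
  dot-gen a i j = trans (foldr-tabulate (λ k → a k * gen i j k) id) (sumFin-gen a i j)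

  -- Cycle sums of signed edge vectors

  cycleSum : ∀ {M} → Vec Bool M → (Fin M → ℚ) → ℚ
  cycleSum []          y = 0ℚ
  cycleSum (true ∷ c)  y = y zero + cycleSum c (y ∘ suc)
  cycleSum (false ∷ c) y = cycleSum c (y ∘ suc)

  cycleSum-cong : ∀ {M} (c : Vec Bool M) {y y′} → (∀ e → y e ≡ y′ e) → cycleSum c y ≡ cycleSum c y′
  cycleSum-cong []          eq = refl
  cycleSum-cong (true ∷ c)  eq = cong₂ _+_ (eq zero) (cycleSum-cong c (eq ∘ suc))
  cycleSum-cong (false ∷ c) eq = cycleSum-cong c (eq ∘ suc)

  cycleSum-update-on : ∀ {M} (c : Vec Bool M) e t y → lookup c e ≡ true →
    cycleSum c (updateAt y e (_+ t)) ≡ cycleSum c y + t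
  cycleSum-update-on (true ∷ c)  zero    t y on =
    solve 3 (λ x t s → x :+ t :+ s := x :+ s :+ t) refl (y zero) t (cycleSum c (y ∘ suc))
  cycleSum-update-on (true ∷ c)  (suc e) t y on =
    trans (cong (y zero +_) (cycleSum-update-on c e t (y ∘ suc) on))
          (sym (+-assoc (y zero) (cycleSum c (y ∘ suc)) t))
  cycleSum-update-on (false ∷ c) (suc e) t y on = cycleSum-update-on c e t (y ∘ suc) on

  cycleSum-update-off : ∀ {M} (c : Vec Bool M) e t y → lookup c e ≡ false →
    cycleSum c (updateAt y e (_+ t)) ≡ cycleSum c y
  cycleSum-update-off (false ∷ c) zero    t y off = refl
  cycleSum-update-off (true ∷ c)  (suc e) t y off =
    cong (y zero +_) (cycleSum-update-off c e t (y ∘ suc) off)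
  cycleSum-update-off (false ∷ c) (suc e) t y off = cycleSum-update-off c e t (y ∘ suc) off

  -- Weaker than `HasSign` at `null`: it is what remains known when a face is enlarged, since a
  -- slack edge might become tight there.
  Fits : ℚ → ℚ → Sgn → Set
  Fits b x plus  = x ≡ b
  Fits b x null  = ⊤
  Fits b x minus = x ≡ - b

  HasSign : ℚ → ℚ → Sgn → Set
  HasSign b x plus  = x ≡ b
  HasSign b x null  = - b < x × x < b
  HasSign b x minus = x ≡ - b

  hasSign⇒fits : ∀ {b x} s → HasSign b x s → Fits b x s
  hasSign⇒fits plus  h = h
  hasSign⇒fits null  h = tt
  hasSign⇒fits minus h = h

  ≤∧≢⇒< : ∀ {x y} → x ≤ y → x ≢ y → x < y
  ≤∧≢⇒< x≤y x≢y = ≰⇒> (x≢y ∘ ≤-antisym x≤y)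

  sign-exists : ∀ b x → - b ≤ x → x ≤ b → ∃ (HasSign b x)
  sign-exists b x -b≤x x≤b with x ≟ b | x ≟ - b
  ... | yes x≡b | _ = plus , x≡b
  ... | no _ | yes x≡-b = minus , x≡-b
  ... | no x≢b | no x≢-b = null , ≤∧≢⇒< -b≤x (x≢-b ∘ sym) , ≤∧≢⇒< x≤b x≢b

  signs-exist : ∀ {M} b (y : Fin M → ℚ) → (∀ e → - b ≤ y e × y e ≤ b) →
    ∃ λ w → ∀ e → HasSign b (y e) (lookup w e)
  signs-exist {zero}  b y bounds = [] , λ ()
  signs-exist {suc M} b y bounds =
    let s , h = sign-exists b (y zero) (proj₁ (bounds zero)) (proj₂ (bounds zero))
        w , hs = signs-exist b (y ∘ suc) (bounds ∘ suc)
    in s ∷ w , λ { zero → h ; (suc e) → hs e }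

  word₀-noNull : ∀ {M} {c : Vec Bool M} {w p q} → Word c w p q 0 → ∀ e → lookup w e ≢ null
  word₀-noNull (free₊ W) (suc e) = word₀-noNull W e
  word₀-noNull (free₋ W) (suc e) = word₀-noNull W e
  word₀-noNull (cyc₊ W)  (suc e) = word₀-noNull W e
  word₀-noNull (cyc₋ W)  (suc e) = word₀-noNull W e

  -- The minus edges are moved to the side of the sum, so that both counts appear as natural
  -- multiples of `b`, the form that `·-separated` needs.
  cycleSum-word₀ : ∀ {M} {c : Vec Bool M} {w p q} b y → Word c w p q 0 →
    (∀ e → Fits b (y e) (lookup w e)) → cycleSum c y + q · b ≡ p · b
  cycleSum-word₀ b y []        fit = refl
  cycleSum-word₀ b y (free₊ W) fit = cycleSum-word₀ b (y ∘ suc) W (fit ∘ suc)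
  cycleSum-word₀ b y (free₋ W) fit = cycleSum-word₀ b (y ∘ suc) W (fit ∘ suc)
  cycleSum-word₀ b y (cyc₊ {c = c} {q = q} W) fit =
    trans (+-assoc (y zero) (cycleSum c (y ∘ suc)) (q · b))
          (cong₂ _+_ (fit zero) (cycleSum-word₀ b (y ∘ suc) W (fit ∘ suc)))
  cycleSum-word₀ b y (cyc₋ {c = c} {q = q} W) fit =
    trans (cong (λ x → x + cycleSum c (y ∘ suc) + (b + q · b)) (fit zero))
    (trans (solve 3 (λ b s t → :- b :+ s :+ (b :+ t) := s :+ t) refl b (cycleSum c (y ∘ suc)) (q · b))
           (cycleSum-word₀ b (y ∘ suc) W (fit ∘ suc)))

  cycleSum-word₁ : ∀ {M} {c : Vec Bool M} {w p q} b y → Word c w p q 1 →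
    (∀ e → Fits b (y e) (lookup w e)) →
    ∃ λ e → lookup w e ≡ null × (∀ e′ → lookup w e′ ≡ null → e′ ≡ e) ×
            cycleSum c y + q · b ≡ p · b + y e
  cycleSum-word₁ b y (free₊ W) fit with cycleSum-word₁ b (y ∘ suc) W (fit ∘ suc)
  ... | e , isNull , only , eq = suc e , isNull , (λ { (suc e′) n → cong suc (only e′ n) }) , eq
  cycleSum-word₁ b y (free₋ W) fit with cycleSum-word₁ b (y ∘ suc) W (fit ∘ suc)
  ... | e , isNull , only , eq = suc e , isNull , (λ { (suc e′) n → cong suc (only e′ n) }) , eq
  cycleSum-word₁ b y (cyc₊ {c = c} {p = p} {q = q} W) fit with cycleSum-word₁ b (y ∘ suc) W (fit ∘ suc)
  ... | e , isNull , only , eq = suc e , isNull , (λ { (suc e′) n → cong suc (only e′ n) }) ,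
    trans (+-assoc (y zero) (cycleSum c (y ∘ suc)) (q · b))
    (trans (cong₂ _+_ (fit zero) eq) (sym (+-assoc b (p · b) (y (suc e)))))
  cycleSum-word₁ b y (cyc₋ {c = c} {q = q} W) fit with cycleSum-word₁ b (y ∘ suc) W (fit ∘ suc)
  ... | e , isNull , only , eq = suc e , isNull , (λ { (suc e′) n → cong suc (only e′ n) }) ,
    trans (cong (λ x → x + cycleSum c (y ∘ suc) + (b + q · b)) (fit zero))
    (trans (solve 3 (λ b s t → :- b :+ s :+ (b :+ t) := s :+ t) refl b (cycleSum c (y ∘ suc)) (q · b)) eq)
  cycleSum-word₁ b y (cyc₀ {c = c} {p = p} {q = q} W) fit =
    zero , refl , (λ { zero n → refl ; (suc e′) n → ⊥-elim (word₀-noNull W e′ n) }) ,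
    trans (+-assoc (y zero) (cycleSum c (y ∘ suc)) (q · b))
    (trans (cong (y zero +_) (cycleSum-word₀ b (y ∘ suc) W (fit ∘ suc))) (+-comm (y zero) (p · b)))

  ·-nonNeg : ∀ {b} → 0ℚ < b → ∀ r → 0ℚ ≤ r · b
  ·-nonNeg 0<b zero    = ≤-refl
  ·-nonNeg 0<b (suc r) = +-mono-≤ (<⇒≤ 0<b) (·-nonNeg 0<b r)

  -- Distinct multiples of `b` are at least `b` apart, and `x` is strictly shorter than that. The
  -- induction strips one `b` from each side until a count is exhausted.
  ·-separated : ∀ {b x} → 0ℚ < b → - b < x → x < b → ∀ p q → q · b ≡ p · b + x → p ≡ q
  ·-separated 0<b lo hi zero zero eq = refl
  ·-separated {b} {x} 0<b lo hi zero (suc q) eq = ⊥-elim (<-irrefl refl (<-≤-trans hi (begin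
    b           ≡⟨ sym (+-identityʳ b) ⟩
    b + 0ℚ      ≤⟨ +-monoʳ-≤ b (·-nonNeg 0<b q) ⟩
    b + q · b   ≡⟨ eq ⟩
    0ℚ + x      ≡⟨ +-identityˡ x ⟩
    x           ∎)))
    where open ≤-Reasoning
  ·-separated {b} {x} 0<b lo hi (suc p) zero eq = ⊥-elim (<-irrefl refl (<-≤-trans lo (begin
    x                       ≡⟨ solve 3 (λ b t x → x := (b :+ t :+ x) :- (b :+ t)) refl b (p · b) x ⟩
    (b + p · b + x) - (b + p · b) ≡⟨ cong (_- (b + p · b)) (sym eq) ⟩
    0ℚ - (b + p · b)        ≡⟨ solve 2 (λ b t → con 0ℚ :- (b :+ t) := :- b :- t) refl b (p · b) ⟩
    - b - p · b             ≤⟨ +-monoʳ-≤ (- b) (neg-antimono-≤ (·-nonNeg 0<b p)) ⟩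
    - b + 0ℚ                ≡⟨ +-identityʳ (- b) ⟩
    - b                     ∎)))
    where open ≤-Reasoning
  ·-separated {b} {x} 0<b lo hi (suc p) (suc q) eq = cong suc (·-separated 0<b lo hi p q
    (+-cancelˡ b (q · b) (p · b + x) (trans eq (+-assoc b (p · b) x))))

  -- A zero cycle sum reads q b = p b + x, with x = 0 if no edge is slack and x the difference on
  -- the slack edge otherwise; `·-separated` covers both cases.
  balanced : ∀ {M} {c : Vec Bool M} {w p q z b y} → 0ℚ < b → z ≡ 0 ⊎ z ≡ 1 → Word c w p q z →
    (∀ e → HasSign b (y e) (lookup w e)) → cycleSum c y ≡ 0ℚ → p ≡ q
  balanced {w = w} {p} {q} {b = b} {y} 0<b (inj₁ refl) W sgn s≡0 =
    ·-separated 0<b (neg-antimono-< 0<b) 0<b p q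
      (trans (sym (+-identityˡ (q · b))) (trans (cong (_+ q · b) (sym s≡0))
      (trans (cycleSum-word₀ b y W (λ e → hasSign⇒fits (lookup w e) (sgn e))) (sym (+-identityʳ (p · b))))))
  balanced {w = w} {p} {q} {b = b} {y} 0<b (inj₂ refl) W sgn s≡0
    with cycleSum-word₁ b y W (λ e → hasSign⇒fits (lookup w e) (sgn e))
  ... | e , isNull , _ , eq = ·-separated 0<b (proj₁ between) (proj₂ between) p q
      (trans (sym (+-identityˡ (q · b))) (trans (cong (_+ q · b) (sym s≡0)) eq))
    where
    between : HasSign b (y e) null
    between = subst (HasSign b (y e)) isNull (sgn e)

  word₀-exists : ∀ {M} (c : Vec Bool M) w → (∀ e → lookup w e ≢ null) → ∃₂ λ p q → Word c w p q 0
  word₀-exists [] [] h = 0 , 0 , []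
  word₀-exists (c₀ ∷ c) (s ∷ w) h with word₀-exists c w (h ∘ suc)
  word₀-exists (true ∷ c)  (plus ∷ w)  h | p , q , W = suc p , q , cyc₊ W
  word₀-exists (true ∷ c)  (minus ∷ w) h | p , q , W = p , suc q , cyc₋ W
  word₀-exists (false ∷ c) (plus ∷ w)  h | p , q , W = p , q , free₊ W
  word₀-exists (false ∷ c) (minus ∷ w) h | p , q , W = p , q , free₋ W
  word₀-exists (c₀ ∷ c)    (null ∷ w)  h | _ = ⊥-elim (h zero refl)

  word-exists : ∀ {M} (c : Vec Bool M) w → (∀ e → lookup w e ≡ null → lookup c e ≡ true) →
    (∀ e e′ → lookup w e ≡ null → lookup w e′ ≡ null → e ≡ e′) →
    ∃₂ λ p q → ∃ λ z → (z ≡ 0 ⊎ z ≡ 1) × Word c w p q z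
  word-exists [] [] on uniq = 0 , 0 , 0 , inj₁ refl , []
  -- Uniqueness leaves no second `null` in the tail, and `on` forces the present edge to be a cycle
  -- edge.
  word-exists (c₀ ∷ c) (null ∷ w) on uniq with on zero refl
    | word₀-exists c w (λ e n → Fin.0≢1+n (uniq zero (suc e) refl n))
  ... | refl | p , q , W = p , q , 1 , inj₂ refl , cyc₀ W
  word-exists (c₀ ∷ c) (plus ∷ w) on uniq
    with word-exists c w (on ∘ suc) (λ e e′ n n′ → Fin.suc-injective (uniq (suc e) (suc e′) n n′))
  word-exists (true ∷ c)  (plus ∷ w) on uniq | p , q , z , z≤1 , W = suc p , q , z , z≤1 , cyc₊ W
  word-exists (false ∷ c) (plus ∷ w) on uniq | p , q , z , z≤1 , W = p , q , z , z≤1 , free₊ W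
  word-exists (c₀ ∷ c) (minus ∷ w) on uniq
    with word-exists c w (on ∘ suc) (λ e e′ n n′ → Fin.suc-injective (uniq (suc e) (suc e′) n n′))
  word-exists (true ∷ c)  (minus ∷ w) on uniq | p , q , z , z≤1 , W = p , suc q , z , z≤1 , cyc₋ W
  word-exists (false ∷ c) (minus ∷ w) on uniq | p , q , z , z≤1 , W = p , q , z , z≤1 , free₋ W

  -- G is unicyclic with cycle edges marked in c, oriented around the cycle: a function on the
  -- edges is the difference of a vertex potential iff it sums to zero over the cycle.
  record Presentation {n} (G : Graph n) {M} (c : Vec Bool M) : Set where
    field
      src tgt     : Fin M → Fin n
      adjacent    : ∀ e → Adj G (src e) (tgt e) ≡ true
      cover       : ∀ i j → Adj G i j ≡ true →
                    ∃ λ e → (i ≡ src e × j ≡ tgt e) ⊎ (i ≡ tgt e × j ≡ src e)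
      potential   : ∀ y → cycleSum c y ≡ 0ℚ → ∃ λ (a : Point n) → ∀ e → a (src e) - a (tgt e) ≡ y e
      circulation : ∀ (a : Point n) → cycleSum c (λ e → a (src e) - a (tgt e)) ≡ 0ℚ

  -- Faces as supporting potentials

  Adj-sym : ∀ {n} (G : Graph n) i j → Adj G i j ≡ Adj G j i
  Adj-sym G i j = ∨-comm ((toℕ i ℕ.<ᵇ toℕ j) ∧ G i j) ((toℕ j ℕ.<ᵇ toℕ i) ∧ G j i)

  lookup-ext : ∀ {A : Set} {n} {xs ys : Vec A n} → (∀ i → lookup xs i ≡ lookup ys i) → xs ≡ ys
  lookup-ext {xs = xs} {ys} eq =
    trans (sym (tabulate∘lookup xs)) (trans (tabulate-cong eq) (tabulate∘lookup ys))

  ⇔true⇒≡ : ∀ {x y : Bool} → (x ≡ true → y ≡ true) → (y ≡ true → x ≡ true) → x ≡ y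
  ⇔true⇒≡ {true}  {y}     f g = sym (f refl)
  ⇔true⇒≡ {false} {false} f g = refl
  ⇔true⇒≡ {false} {true}  f g = g refl

  genSet-ext : ∀ {n} {S T : GenSet n} → S ⊆ₛ T → T ⊆ₛ S → S ≡ T
  genSet-ext S⊆T T⊆S = lookup-ext λ i → lookup-ext λ j → ⇔true⇒≡ (S⊆T i j) (T⊆S i j)

  neg-flip : ∀ x y → y - x ≡ - (x - y)
  neg-flip = solve 2 (λ x y → y :- x := :- (x :- y)) refl

  neg-neg : ∀ x → - (- x) ≡ x
  neg-neg = solve 1 (λ x → :- (:- x) := x) refl

  record Supports {n} (G : Graph n) (S : GenSet n) (a : Point n) (b : ℚ) : Set where
    constructor supports
    field
      valid : ∀ i j → Adj G i j ≡ true → a i - a j ≤ b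
      tight : ∀ i j → ((S ∋ₛ i , j) ≡ true) ⇔ (Adj G i j ≡ true × a i - a j ≡ b)

  face⇒supports : ∀ {n} {G : Graph n} {S} → IsFace G S → ∃₂ (Supports G S)
  face⇒supports (a , b , valid , tight) = a , b , supports
    (λ i j adj → subst (_≤ b) (dot-gen a i j) (valid i j adj))
    (λ i j → mk⇔
      (λ m → let adj , eq = to (tight i j) m in adj , trans (sym (dot-gen a i j)) eq)
      (λ (adj , eq) → from (tight i j) (adj , trans (dot-gen a i j) eq)))

  supports⇒face : ∀ {n} {G : Graph n} {S a b} → Supports G S a b → IsFace G S
  supports⇒face {a = a} {b} (supports valid tight) = a , b ,
    (λ i j adj → subst (_≤ b) (sym (dot-gen a i j)) (valid i j adj)) ,
    (λ i j → mk⇔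
      (λ m → let adj , eq = to (tight i j) m in adj , trans (dot-gen a i j) eq)
      (λ (adj , eq) → from (tight i j) (adj , trans (sym (dot-gen a i j)) eq)))

  -- If b ≤ 0, the inequalities for the two orientations of an edge squeeze its difference to `b`,
  -- and every generator would lie on the face.
  supports-positive : ∀ {n} {G : Graph n} {S a b} → Supports G S a b → IsProper G S → 0ℚ < b
  supports-positive {G = G} {S} {a} {b} (supports valid tight) proper = ≰⇒> λ b≤0 →
    proper λ i j adj → from (tight i j) (adj , ≤-antisym (valid i j adj) (begin
      b                 ≤⟨ b≤0 ⟩
      0ℚ                ≤⟨ neg-antimono-≤ b≤0 ⟩
      - b               ≤⟨ neg-antimono-≤ (valid j i (trans (Adj-sym G j i) adj)) ⟩
      - (a j - a i)     ≡⟨ sym (neg-flip (a j) (a i)) ⟩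
      a i - a j         ∎))
    where open ≤-Reasoning

  tightSet : ∀ {n} → Graph n → Point n → ℚ → GenSet n
  tightSet G a b = Vec.tabulate λ i → Vec.tabulate λ j → Adj G i j ∧ does (a i - a j ≟ b)

  tightSet-∋ : ∀ {n} (G : Graph n) a b i j →
    ((tightSet G a b ∋ₛ i , j) ≡ true) ⇔ (Adj G i j ≡ true × a i - a j ≡ b)
  tightSet-∋ G a b i j = mk⇔ (λ m → fwd (trans (sym entry) m)) (λ h → trans entry (bwd h))
    where
    entry : (tightSet G a b ∋ₛ i , j) ≡ Adj G i j ∧ does (a i - a j ≟ b)
    entry = trans (cong (λ row → lookup row j) (lookup∘tabulate _ i)) (lookup∘tabulate _ j)
    fwd : Adj G i j ∧ does (a i - a j ≟ b) ≡ true → Adj G i j ≡ true × a i - a j ≡ b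
    fwd h with Adj G i j | a i - a j ≟ b
    ... | true | yes eq = refl , eq
    bwd : Adj G i j ≡ true × a i - a j ≡ b → Adj G i j ∧ does (a i - a j ≟ b) ≡ true
    bwd (adj , eq) = cong₂ _∧_ adj (dec-true (a i - a j ≟ b) eq)

  -b<b : ∀ {b} → 0ℚ < b → - b < b
  -b<b 0<b = <-trans (neg-antimono-< 0<b) 0<b

  -- On the null edge of a balanced word, 0 is the only value that makes the cycle sum vanish,
  -- because the other cycle edges cancel.
  value : ℚ → Sgn → ℚ
  value b plus  = b
  value b null  = 0ℚ
  value b minus = - b

  value-hasSign : ∀ {b} → 0ℚ < b → ∀ s → HasSign b (value b s) s
  value-hasSign 0<b plus  = refl
  value-hasSign 0<b null  = neg-antimono-< 0<b , 0<b
  value-hasSign 0<b minus = refl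

  hasSign-bounds : ∀ {b x} → 0ℚ < b → ∀ s → HasSign b x s → - b ≤ x × x ≤ b
  hasSign-bounds 0<b plus  refl      = <⇒≤ (-b<b 0<b) , ≤-refl
  hasSign-bounds 0<b null  (lo , hi) = <⇒≤ lo , <⇒≤ hi
  hasSign-bounds 0<b minus refl      = ≤-refl , <⇒≤ (-b<b 0<b)

  hasSign-plus : ∀ {b x} → 0ℚ < b → ∀ s → HasSign b x s → x ≡ b ⇔ s ≡ plus
  hasSign-plus 0<b plus  h        = mk⇔ (λ _ → refl) (λ _ → h)
  hasSign-plus 0<b null  (_ , hi) = mk⇔ (λ x≡b → ⊥-elim (<⇒≢ hi x≡b)) (λ ())
  hasSign-plus 0<b minus refl     = mk⇔ (λ x≡b → ⊥-elim (<⇒≢ (-b<b 0<b) x≡b)) (λ ())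

  hasSign-minus : ∀ {b x} → 0ℚ < b → ∀ s → HasSign b x s → x ≡ - b ⇔ s ≡ minus
  hasSign-minus 0<b plus  refl     = mk⇔ (λ x≡-b → ⊥-elim (<⇒≢ (-b<b 0<b) (sym x≡-b))) (λ ())
  hasSign-minus 0<b null  (lo , _) = mk⇔ (λ x≡-b → ⊥-elim (<⇒≢ lo (sym x≡-b))) (λ ())
  hasSign-minus 0<b minus h        = mk⇔ (λ _ → refl) (λ _ → h)

  -- Facets against balanced words

  module Facets {n} {G : Graph n} {M} {c : Vec Bool M} (P : Presentation G c) where
    open Presentation P

    diff : Point n → Fin M → ℚ
    diff a e = a (src e) - a (tgt e)

    -- The field `edges` is there because a Boolean matrix could also mark non-adjacent pairs, about
    -- which the word says nothing.
    record Encodes (S : GenSet n) (w : Vec Sgn M) : Set where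
      field
        forward  : ∀ e → ((S ∋ₛ src e , tgt e) ≡ true) ⇔ (lookup w e ≡ plus)
        backward : ∀ e → ((S ∋ₛ tgt e , src e) ≡ true) ⇔ (lookup w e ≡ minus)
        edges    : ∀ i j → (S ∋ₛ i , j) ≡ true → Adj G i j ≡ true
    open Encodes

    encodes-⊆ : ∀ {S T w} → Encodes S w → Encodes T w → S ⊆ₛ T
    encodes-⊆ ES ET i j S∋ with cover i j (edges ES i j S∋)
    ... | e , inj₁ (refl , refl) = from (forward ET e) (to (forward ES e) S∋)
    ... | e , inj₂ (refl , refl) = from (backward ET e) (to (backward ES e) S∋)

    encodes-injective : ∀ {S T w} → Encodes S w → Encodes T w → S ≡ T
    encodes-injective ES ET = genSet-ext (encodes-⊆ ES ET) (encodes-⊆ ET ES)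

    encodes-functional : ∀ {S w w′} → Encodes S w → Encodes S w′ → w ≡ w′
    encodes-functional {S} {w} {w′} E E′ = lookup-ext λ e →
      same (λ h → to (forward E′ e) (from (forward E e) h))
           (λ h → to (backward E′ e) (from (backward E e) h))
           (λ h → to (forward E e) (from (forward E′ e) h))
           (λ h → to (backward E e) (from (backward E′ e) h))
      where
      same : ∀ {s t} → (s ≡ plus → t ≡ plus) → (s ≡ minus → t ≡ minus) →
             (t ≡ plus → s ≡ plus) → (t ≡ minus → s ≡ minus) → s ≡ t
      same {plus}          f _ _ _ = sym (f refl)
      same {minus}         _ g _ _ = sym (g refl)
      same {null}  {null}  _ _ _ _ = refl
      same {null}  {plus}  _ _ f _ = f refl
      same {null}  {minus} _ _ _ g = g refl

    adjacentʳ : ∀ e → Adj G (tgt e) (src e) ≡ true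
    adjacentʳ e = trans (Adj-sym G (tgt e) (src e)) (adjacent e)

    tight-forward : ∀ {S a b} → Supports G S a b → ∀ e →
      ((S ∋ₛ src e , tgt e) ≡ true) ⇔ (diff a e ≡ b)
    tight-forward sup e = mk⇔ (λ m → proj₂ (to (tight (src e) (tgt e)) m))
                              (λ eq → from (tight (src e) (tgt e)) (adjacent e , eq))
      where open Supports sup

    tight-backward : ∀ {S a b} → Supports G S a b → ∀ e →
      ((S ∋ₛ tgt e , src e) ≡ true) ⇔ (diff a e ≡ - b)
    tight-backward {a = a} {b} sup e = mk⇔
      (λ m → trans (neg-flip (a (tgt e)) (a (src e))) (cong -_ (proj₂ (to (tight (tgt e) (src e)) m))))
      (λ eq → from (tight (tgt e) (src e)) (adjacentʳ e ,
        trans (neg-flip (a (src e)) (a (tgt e))) (trans (cong -_ eq) (neg-neg b))))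
      where open Supports sup

    supports-encodes : ∀ {S a b w} → 0ℚ < b → Supports G S a b →
      (∀ e → HasSign b (diff a e) (lookup w e)) → Encodes S w
    supports-encodes {w = w} 0<b sup sgn = record
      { forward  = λ e → hasSign-plus 0<b (lookup w e) (sgn e) ⇔-∘ tight-forward sup e
      ; backward = λ e → hasSign-minus 0<b (lookup w e) (sgn e) ⇔-∘ tight-backward sup e
      ; edges    = λ i j m → proj₁ (to (Supports.tight sup i j) m)
      }

    diff-bounds : ∀ {S a b} → Supports G S a b → ∀ e → - b ≤ diff a e × diff a e ≤ b
    diff-bounds {a = a} {b} (supports valid _) e =
      subst (- b ≤_) (sym (neg-flip (a (tgt e)) (a (src e))))
        (neg-antimono-≤ (valid (tgt e) (src e) (adjacentʳ e))) ,
      valid (src e) (tgt e) (adjacent e)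

    tightSet-supports : ∀ {a b} → (∀ e → - b ≤ diff a e × diff a e ≤ b) →
      Supports G (tightSet G a b) a b
    tightSet-supports {a} {b} bounds = supports valid (tightSet-∋ G a b)
      where
      valid : ∀ i j → Adj G i j ≡ true → a i - a j ≤ b
      valid i j adj with cover i j adj
      ... | e , inj₁ (refl , refl) = proj₂ (bounds e)
      ... | e , inj₂ (refl , refl) =
        subst₂ _≤_ (sym (neg-flip (a (src e)) (a (tgt e)))) (neg-neg b) (neg-antimono-≤ (proj₁ (bounds e)))

    -- Already one edge with both orientations tight would give b = - b.
    supports-proper : ∀ {S a b} → 0ℚ < b → Supports G S a b → Fin M → IsProper G S
    supports-proper 0<b sup e all = <⇒≢ (-b<b 0<b) (trans
      (sym (to (tight-backward sup e) (all (tgt e) (src e) (adjacentʳ e))))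
      (to (tight-forward sup e) (all (src e) (tgt e) (adjacent e))))

    module _ {S : GenSet n} (facet : IsFacet G S) {a b} (sup : Supports G S a b) (0<b : 0ℚ < b) where

      -- The perturbation principle: such a `y` is the difference of a potential whose face contains
      -- `S` and is proper, hence equals `S`, so no edge can have become tight.
      facet-maximal : ∀ y → cycleSum c y ≡ 0ℚ → (∀ e → - b ≤ y e × y e ≤ b) →
        (∀ e → diff a e ≡ b → y e ≡ b) → (∀ e → diff a e ≡ - b → y e ≡ - b) →
        ∀ e → (y e ≡ b → diff a e ≡ b) × (y e ≡ - b → diff a e ≡ - b)
      facet-maximal y y-sum y-bounds keep₊ keep₋ e =
        (λ eq → to (tight-forward sup e)
          (T⊆S (src e) (tgt e) (from (tight-forward supT e) (trans (a′-diff e) eq)))) ,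
        (λ eq → to (tight-backward sup e)
          (T⊆S (tgt e) (src e) (from (tight-backward supT e) (trans (a′-diff e) eq))))
        where
        a′ : Point n
        a′ = proj₁ (potential y y-sum)
        a′-diff : ∀ e → diff a′ e ≡ y e
        a′-diff = proj₂ (potential y y-sum)
        T : GenSet n
        T = tightSet G a′ b
        supT : Supports G T a′ b
        supT = tightSet-supports λ e → subst (λ x → - b ≤ x × x ≤ b) (sym (a′-diff e)) (y-bounds e)
        S⊆T : S ⊆ₛ T
        S⊆T i j S∋ with cover i j (proj₁ (to (Supports.tight sup i j) S∋))
        ... | e , inj₁ (refl , refl) = from (tight-forward supT e)
          (trans (a′-diff e) (keep₊ e (to (tight-forward sup e) S∋)))
        ... | e , inj₂ (refl , refl) = from (tight-backward supT e)
          (trans (a′-diff e) (keep₋ e (to (tight-backward sup e) S∋)))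
        T≡S : T ≡ S
        T≡S = proj₂ (proj₂ facet) T (supports⇒face supT) (supports-proper 0<b supT e) S⊆T
        T⊆S : T ⊆ₛ S
        T⊆S i j = subst (λ U → (U ∋ₛ i , j) ≡ true) T≡S

      private
        y : Fin M → ℚ
        y = diff a

      -- An edge off the cycle does not enter the cycle sum, so its difference could be raised to
      -- `b` alone, making a new edge tight.
      slack-on-cycle : ∀ e → HasSign b (y e) null → lookup c e ≡ true
      slack-on-cycle e (lo , hi) with lookup c e in on?
      ... | true = refl
      ... | false = ⊥-elim (<⇒≢ hi (proj₁ (facet-maximal y′ sum bounds
          (keep (<⇒≢ hi)) (keep (λ eq → <⇒≢ lo (sym eq))) e) at))
        where
        y′ : Fin M → ℚ
        y′ = updateAt y e (_+ (b - y e))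
        sum : cycleSum c y′ ≡ 0ℚ
        sum = trans (cycleSum-update-off c e (b - y e) y on?) (circulation a)
        at : y′ e ≡ b
        at = trans (updateAt-updates e y) (solve 2 (λ x b → x :+ (b :- x) := b) refl (y e) b)
        bounds : ∀ e′ → - b ≤ y′ e′ × y′ e′ ≤ b
        bounds e′ with e′ Fin.≟ e
        ... | yes refl = subst (λ x → - b ≤ x × x ≤ b) (sym at) (<⇒≤ (-b<b 0<b) , ≤-refl)
        ... | no e′≢e = subst (λ x → - b ≤ x × x ≤ b) (sym (updateAt-minimal e′ e y e′≢e)) (diff-bounds sup e′)
        keep : ∀ {x} → (y e ≡ x → ⊥) → ∀ e′ → y e′ ≡ x → y′ e′ ≡ x
        keep ≢x e′ eq with e′ Fin.≟ e
        ... | yes refl = ⊥-elim (≢x eq)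
        ... | no e′≢e = trans (updateAt-minimal e′ e y e′≢e) eq

      -- Adding `t` on `e` and subtracting it on `e′` preserves the cycle sum and, both edges being
      -- slack, every tight edge; by `facet-maximal` neither of the two can arrive at its bound.
      no-transfer : ∀ {e e′} t → e ≢ e′ → lookup c e ≡ true → lookup c e′ ≡ true →
        HasSign b (y e) null → HasSign b (y e′) null →
        0ℚ ≤ t → y e + t ≤ b → - b ≤ y e′ - t → y e + t ≢ b × y e′ - t ≢ - b
      no-transfer {e} {e′} t e≢e′ on on′ (lo , hi) (lo′ , hi′) 0≤t ≤b -b≤ =
        (λ eq → <⇒≢ hi (proj₁ (improved e) (trans at eq))) ,
        (λ eq → <⇒≢ lo′ (sym (proj₂ (improved e′) (trans at′ eq))))
        where
        y₁ y′ : Fin M → ℚ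
        y₁ = updateAt y e (_+ t)
        y′ = updateAt y₁ e′ (_+ (- t))
        sum : cycleSum c y′ ≡ 0ℚ
        sum = trans (cycleSum-update-on c e′ (- t) y₁ on′)
          (trans (cong (_+ (- t)) (trans (cycleSum-update-on c e t y on) (cong (_+ t) (circulation a))))
                 (solve 1 (λ t → con 0ℚ :+ t :- t := con 0ℚ) refl t))
        at : y′ e ≡ y e + t
        at = trans (updateAt-minimal e e′ y₁ e≢e′) (updateAt-updates e y)
        at′ : y′ e′ ≡ y e′ - t
        at′ = trans (updateAt-updates e′ y₁) (cong (_- t) (updateAt-minimal e′ e y (e≢e′ ∘ sym)))
        away : ∀ {f} → f ≢ e → f ≢ e′ → y′ f ≡ y f
        away {f} f≢e f≢e′ = trans (updateAt-minimal f e′ y₁ f≢e′) (updateAt-minimal f e y f≢e)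
        bounds : ∀ f → - b ≤ y′ f × y′ f ≤ b
        bounds f with f Fin.≟ e | f Fin.≟ e′
        ... | yes refl | _ = subst (λ x → - b ≤ x × x ≤ b) (sym at)
          (≤-trans (<⇒≤ lo) (subst (_≤ y e + t) (+-identityʳ (y e)) (+-monoʳ-≤ (y e) 0≤t)) , ≤b)
        ... | no _ | yes refl = subst (λ x → - b ≤ x × x ≤ b) (sym at′)
          (-b≤ , ≤-trans (subst (y e′ - t ≤_) (+-identityʳ (y e′)) (+-monoʳ-≤ (y e′) (neg-antimono-≤ 0≤t))) (<⇒≤ hi′))
        ... | no f≢e | no f≢e′ = subst (λ x → - b ≤ x × x ≤ b) (sym (away f≢e f≢e′)) (diff-bounds sup f)
        keep : ∀ {x} → y e ≢ x → y e′ ≢ x → ∀ f → y f ≡ x → y′ f ≡ x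
        keep ≢x ≢x′ f eq with f Fin.≟ e | f Fin.≟ e′
        ... | yes refl | _ = ⊥-elim (≢x eq)
        ... | no _ | yes refl = ⊥-elim (≢x′ eq)
        ... | no f≢e | no f≢e′ = trans (away f≢e f≢e′) eq
        improved : ∀ f → (y′ f ≡ b → y f ≡ b) × (y′ f ≡ - b → y f ≡ - b)
        improved = facet-maximal y′ sum bounds (keep (<⇒≢ hi) (<⇒≢ hi′))
          (keep (λ eq → <⇒≢ lo (sym eq)) (λ eq → <⇒≢ lo′ (sym eq)))

      -- Otherwise push one slack edge up and the other down by the smaller of the two
      -- available amounts: the circulation condition persists and a new edge becomes tight.
      slack-unique : ∀ {e e′} → HasSign b (y e) null → HasSign b (y e′) null → e ≡ e′
      slack-unique {e} {e′} s@(lo , hi) s′@(lo′ , hi′) with e Fin.≟ e′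
      ... | yes e≡e′ = e≡e′
      ... | no e≢e′ with ≤-total (b - y e) (b + y e′)
      ... | inj₁ le = ⊥-elim (proj₁
        (no-transfer (b - y e) e≢e′ (slack-on-cycle e s) (slack-on-cycle e′ s′) s s′
          (subst (_≤ b - y e) (+-inverseʳ (y e)) (+-monoˡ-≤ (- y e) (<⇒≤ hi)))
          (≤-reflexive full)
          (subst₂ _≤_ (solve 2 (λ x b → :- (b :+ x) :+ x := :- b) refl (y e′) b)
                      (+-comm (- (b - y e)) (y e′))
                      (+-monoˡ-≤ (y e′) (neg-antimono-≤ le)))) full)
        where
        full : y e + (b - y e) ≡ b
        full = solve 2 (λ x b → x :+ (b :- x) := b) refl (y e) b
      ... | inj₂ ge = ⊥-elim (proj₂
        (no-transfer (b + y e′) e≢e′ (slack-on-cycle e s) (slack-on-cycle e′ s′) s s′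
          (subst (_≤ b + y e′) (+-inverseʳ b) (+-monoʳ-≤ b (<⇒≤ lo′)))
          (subst (y e + (b + y e′) ≤_) (solve 2 (λ x b → x :+ (b :- x) := b) refl (y e) b)
            (+-monoʳ-≤ (y e) ge))
          (≤-reflexive (sym full))) full)
        where
        full : y e′ - (b + y e′) ≡ - b
        full = solve 2 (λ x b → x :- (b :+ x) := :- b) refl (y e′) b

    Balanced : Vec Sgn M → Set
    Balanced w = ∃₂ λ k z → (z ≡ 0 ⊎ z ≡ 1) × Word c w k k z

    facet⇒balanced : ∀ {S} → IsFacet G S → ∀ {a b} → Supports G S a b → 0ℚ < b → ∀ w →
      (∀ e → HasSign b (diff a e) (lookup w e)) → Balanced w
    facet⇒balanced facet {a} {b} sup 0<b w sgn =
      let p , q , z , z≤1 , W = word-exists c w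
            (λ e isNull → slack-on-cycle facet sup 0<b e (slack e isNull))
            (λ e e′ isNull isNull′ → slack-unique facet sup 0<b (slack e isNull) (slack e′ isNull′))
          p≡q = balanced 0<b z≤1 W sgn (circulation a)
      in p , z , z≤1 , subst (λ r → Word c w p r z) (sym p≡q) W
      where
      slack : ∀ e → lookup w e ≡ null → HasSign b (diff a e) null
      slack e isNull = subst (HasSign b (diff a e)) isNull (sgn e)

    facet⇒word : ∀ {S} → IsFacet G S → ∃ λ w → Encodes S w × Balanced w
    facet⇒word facet@(face , proper , _) =
      let a , b , sup = face⇒supports face
          0<b = supports-positive sup proper
          w , sgn = signs-exist b (diff a) (diff-bounds sup)
      in w , supports-encodes 0<b sup sgn , facet⇒balanced facet sup 0<b w sgn

    -- On the null edge `Fits` is silent, but the signs elsewhere on the cycle cancel, so the cycle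
    -- sum leaves 0 there, strictly between the bounds.
    cycleSum-forces-sign : ∀ {w y b} → Balanced w → 0ℚ < b → (∀ e → Fits b (y e) (lookup w e)) →
      cycleSum c y ≡ 0ℚ → ∀ e → HasSign b (y e) (lookup w e)
    cycleSum-forces-sign {w} {y} {b} (k , z , z≤1 , W) 0<b fit sum e with lookup w e in eq | fit e
    ... | plus  | h = h
    ... | minus | h = h
    ... | null  | _ = subst (λ x → - b < x × x < b) (sym (is0 z≤1 W)) (neg-antimono-< 0<b , 0<b)
      where
      is0 : ∀ {z} → z ≡ 0 ⊎ z ≡ 1 → Word c w k k z → y e ≡ 0ℚ
      is0 (inj₁ refl) W = ⊥-elim (word₀-noNull W e eq)
      is0 (inj₂ refl) W with cycleSum-word₁ b y W fit
      ... | e₀ , _ , only , s with only e eq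
      ... | refl = +-cancelˡ (k · b) (y e) 0ℚ
        (trans (sym s) (trans (cong (_+ k · b) sum) (+-comm 0ℚ (k · b))))

    balanced-cycleSum : ∀ {w b} → Balanced w → cycleSum c (λ e → value b (lookup w e)) ≡ 0ℚ
    balanced-cycleSum {w} {b} (k , z , z≤1 , W) = +-cancelˡ (k · b) _ _
      (trans (+-comm (k · b) _) (trans (total z≤1 W) (sym (+-identityʳ (k · b)))))
      where
      y : Fin M → ℚ
      y e = value b (lookup w e)
      fits : ∀ s → Fits b (value b s) s
      fits plus  = refl
      fits null  = tt
      fits minus = refl
      total : ∀ {z} → z ≡ 0 ⊎ z ≡ 1 → Word c w k k z → cycleSum c y + k · b ≡ k · b
      total (inj₁ refl) W = cycleSum-word₀ b y W (fits ∘ lookup w)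
      total (inj₂ refl) W with cycleSum-word₁ b y W (fits ∘ lookup w)
      ... | e , isNull , _ , s = trans s (trans (cong (k · b +_) (cong (value b) isNull)) (+-identityʳ (k · b)))

    encodes-fits : ∀ {S T w a b} → Encodes S w → Supports G T a b → S ⊆ₛ T →
      ∀ e → Fits b (diff a e) (lookup w e)
    encodes-fits {w = w} ES sup S⊆T e with lookup w e in eq
    ... | plus  = to (tight-forward sup e) (S⊆T (src e) (tgt e) (from (forward ES e) eq))
    ... | null  = tt
    ... | minus = to (tight-backward sup e) (S⊆T (tgt e) (src e) (from (backward ES e) eq))

    -- The larger face comes with its own potential and height. Its differences fit the word of `S`,
    -- hence have exactly those signs, and the word determines the face.
    balanced-maximal : ∀ {S w} → Encodes S w → Balanced w →
      ∀ T → IsFace G T → IsProper G T → S ⊆ₛ T → T ≡ S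
    balanced-maximal ES bal T face proper S⊆T =
      let a , b , sup = face⇒supports face
          0<b = supports-positive sup proper
      in encodes-injective
           (supports-encodes 0<b sup
             (cycleSum-forces-sign bal 0<b (encodes-fits ES sup S⊆T) (circulation a))) ES

    word⇒facet : ∀ {w b} → Fin M → 0ℚ < b → Balanced w → ∃ λ S → Encodes S w × IsFacet G S
    word⇒facet {w} {b} e₀ 0<b bal =
      let a , a-diff = potential (λ e → value b (lookup w e)) (balanced-cycleSum bal)
          sgn = λ e → subst (λ x → HasSign b x (lookup w e)) (sym (a-diff e)) (value-hasSign 0<b (lookup w e))
          sup = tightSet-supports {a} (λ e → hasSign-bounds 0<b (lookup w e) (sgn e))
          ES = supports-encodes 0<b sup sgn
      in tightSet G a b , ES , supports⇒face sup , supports-proper 0<b sup e₀ , balanced-maximal ES bal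

    words≤facets : ∀ {k₂} k z → z ≡ 0 ⊎ z ≡ 1 → Fin M → FacetCount G k₂ → length (words c k k z) ℕ.≤ k₂
    words≤facets k z z≤1 e₀ (L , _ , L-facets , refl) =
      length-≤-injective (λ w S → Encodes S w) encodes-functional (words-unique c k k z)
        -- Any positive height would serve; 1 is taken.
        λ w∈ → let S , E , facet = word⇒facet e₀ (positive⁻¹ 1ℚ) (k , z , z≤1 , ∈words⇒word c k k z w∈)
               in S , from (L-facets S) facet , E

    facets≤words : ∀ {k₁} {ws} → (∀ {w} → Balanced w → w ∈ ws) → FacetCount G k₁ → k₁ ℕ.≤ length ws
    facets≤words complete (L , unique , L-facets , refl) =
      length-≤-injective Encodes encodes-injective unique
        λ {S} S∈ → let w , E , bal = facet⇒word (to (L-facets S) S∈) in w , complete bal , E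

  -- The upper bound from the parity of the cycle length

  parityWords : ∀ {M m} → Vec Bool M → Parity m → List (Vec Sgn M)
  parityWords c (even k) = words c k k 0
  parityWords c (odd k)  = words c k k 1

  length-parityWords : ∀ {M} (c : Vec Bool M) {m} (P : Parity m) → m ≡ trues c →
    length (parityWords c P) ≡ 2 ℕ.^ falses c ℕ.* parityCount P
  length-parityWords c (even k) eq = length-words-cycleCount c k 0
    (trans (ℕ.+-identityʳ (k ℕ.+ k)) (trans (sym (double≡+ k)) eq))
  length-parityWords c (odd k) eq = length-words-cycleCount c k 1
    (trans (ℕ.+-comm (k ℕ.+ k) 1) (trans (cong suc (sym (double≡+ k))) eq))

  -- The word has k + k + z cycle letters with z ≤ 1, so the cycle length determines both `k` and
  -- `z`; this is why a single list of words is complete.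
  balanced∈parityWords : ∀ {M} {c : Vec Bool M} {w k z m} (P : Parity m) → m ≡ trues c →
    z ≡ 0 ⊎ z ≡ 1 → Word c w k k z → w ∈ parityWords c P
  balanced∈parityWords {c = c} {w} {k} P eq z≤1 W = go P z≤1 W (trans (word-size W) (sym eq))
    where
    go : ∀ {m z} (P : Parity m) → z ≡ 0 ⊎ z ≡ 1 → Word c w k k z → k ℕ.+ k ℕ.+ z ≡ m → w ∈ parityWords c P
    go (even j) (inj₁ refl) W eq with double-injective {k} {j}
      (trans (double≡+ k) (trans (sym (ℕ.+-identityʳ (k ℕ.+ k))) eq))
    ... | refl = word⇒∈words W
    go (odd j) (inj₁ refl) W eq = ⊥-elim (double≢suc-double {k} {j}
      (trans (double≡+ k) (trans (sym (ℕ.+-identityʳ (k ℕ.+ k))) eq)))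
    go (even j) (inj₂ refl) W eq = ⊥-elim (double≢suc-double {j} {k}
      (trans (sym eq) (trans (ℕ.+-comm (k ℕ.+ k) 1) (cong suc (sym (double≡+ k))))))
    go (odd j) (inj₂ refl) W eq with double-injective {k} {j}
      (trans (double≡+ k) (ℕ.suc-injective (trans (ℕ.+-comm 1 (k ℕ.+ k)) eq)))
    ... | refl = word⇒∈words W

  facets≤maxCount : ∀ {n} {G : Graph n} {M} {c : Vec Bool M} {k₁} → Presentation G c →
    1 ℕ.≤ trues c → FacetCount G k₁ → k₁ ℕ.≤ maxCount (parity M)
  facets≤maxCount {M = M} {c} {k₁} P 1≤m count = begin
    k₁                                      ≤⟨ Facets.facets≤words P (λ (_ , _ , z≤1 , W) →
                                                 balanced∈parityWords (parity (trues c)) refl z≤1 W) count ⟩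
    length (parityWords c (parity (trues c))) ≡⟨ length-parityWords c (parity (trues c)) refl ⟩
    2 ℕ.^ falses c ℕ.* parityCount (parity (trues c)) ≤⟨ 2^*parityCount≤maxCount (falses c) (trues c) 1≤m ⟩
    maxCount (parity (falses c ℕ.+ trues c)) ≡⟨ cong (maxCount ∘ parity) (trues+falses c) ⟩
    maxCount (parity M)                     ∎
    where open ℕ.≤-Reasoning

  -- Unordered edges in normal form

  length-≤-⊆ : ∀ {A : Set} {xs ys : List A} → Unique xs → (∀ {x} → x ∈ xs → x ∈ ys) →
    length xs ℕ.≤ length ys
  length-≤-⊆ u xs⊆ys = length-≤-injective _≡_ (λ { refl refl → refl }) u λ {x} x∈ → x , xs⊆ys x∈ , refl

  -- The representative of an unordered edge that `edgeCount` lists, smaller index first.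
  norm : ∀ {n} → Fin n × Fin n → Fin n × Fin n
  norm (x , y) = if toℕ x <ᵇ toℕ y then (x , y) else (y , x)

  <ᵇ-true : ∀ {m n} → m ℕ.< n → (m <ᵇ n) ≡ true
  <ᵇ-true = to T-≡ ∘ ℕ.<⇒<ᵇ

  <ᵇ-false : ∀ {m n} → n ℕ.≤ m → (m <ᵇ n) ≡ false
  <ᵇ-false {m} {n} n≤m with m <ᵇ n in eq
  ... | false = refl
  ... | true  = ⊥-elim (ℕ.<⇒≱ (ℕ.<ᵇ⇒< m n (from T-≡ eq)) n≤m)

  norm-cases : ∀ {n} (x y : Fin n) → norm (x , y) ≡ (x , y) ⊎ norm (x , y) ≡ (y , x)
  norm-cases x y with toℕ x <ᵇ toℕ y
  ... | true  = inj₁ refl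
  ... | false = inj₂ refl

  norm-swap : ∀ {n} (x y : Fin n) → norm (x , y) ≡ norm (y , x)
  norm-swap x y with ℕ.<-cmp (toℕ x) (toℕ y)
  ... | tri< x<y _ _ rewrite <ᵇ-true x<y | <ᵇ-false (ℕ.<⇒≤ x<y) = refl
  ... | tri> _ _ y<x rewrite <ᵇ-true y<x | <ᵇ-false (ℕ.<⇒≤ y<x) = refl
  ... | tri≈ _ x≡y _ with Fin.toℕ-injective x≡y
  ... | refl = refl

  norm-≡ : ∀ {n} {i j x y : Fin n} → norm (i , j) ≡ norm (x , y) →
    (i ≡ x × j ≡ y) ⊎ (i ≡ y × j ≡ x)
  norm-≡ {i = i} {j} {x} {y} eq with norm-cases i j | norm-cases x y
  ... | inj₁ p | inj₁ q with trans (sym p) (trans eq q)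
  ... | refl = inj₁ (refl , refl)
  norm-≡ eq | inj₁ p | inj₂ q with trans (sym p) (trans eq q)
  ... | refl = inj₂ (refl , refl)
  norm-≡ eq | inj₂ p | inj₁ q with trans (sym p) (trans eq q)
  ... | refl = inj₂ (refl , refl)
  norm-≡ eq | inj₂ p | inj₂ q with trans (sym p) (trans eq q)
  ... | refl = inj₁ (refl , refl)

  norms : ∀ {n k} → Vec (Fin n × Fin n) k → List (Fin n × Fin n)
  norms []       = []
  norms (p ∷ ps) = norm p ∷ norms ps

  length-norms : ∀ {n k} (ps : Vec (Fin n × Fin n) k) → length (norms ps) ≡ k
  length-norms []       = refl
  length-norms (p ∷ ps) = cong suc (length-norms ps)

  ∈-norms⁻ : ∀ {n k q} (ps : Vec (Fin n × Fin n) k) → q ∈ norms ps → ∃ λ e → q ≡ norm (lookup ps e)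
  ∈-norms⁻ (p ∷ ps) (here eq) = zero , eq
  ∈-norms⁻ (p ∷ ps) (there q∈) with ∈-norms⁻ ps q∈
  ... | e , eq = suc e , eq

  -- Spanning trees and the one edge outside

  module _ {n} (G : Graph n) where

    -- The same expression as in `edgeCount`, so that `edgeCount G` is its length by definition.
    edges : List (Fin n × Fin n)
    edges = filterᵇ (λ p → (toℕ (proj₁ p) <ᵇ toℕ (proj₂ p)) ∧ G (proj₁ p) (proj₂ p))
                    (cartesianProduct (allFin n) (allFin n))

    edges-unique : Unique edges
    edges-unique = Unique.filter⁺ (T? ∘ _) (Unique.cartesianProduct⁺ (Unique.allFin⁺ n) (Unique.allFin⁺ n))

    ∈-edges⁺ : ∀ {x y} → (toℕ x <ᵇ toℕ y) ∧ G x y ≡ true → (x , y) ∈ edges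
    ∈-edges⁺ {x} {y} eq = ∈-filter⁺ (T? ∘ _) (∈-cartesianProduct⁺ (∈-allFin x) (∈-allFin y)) (from T-≡ eq)

    adj⇒norm∈edges : ∀ {x y} → Adj G x y ≡ true → norm (x , y) ∈ edges
    adj⇒norm∈edges {x} {y} adj with ℕ.<-cmp (toℕ x) (toℕ y)
    ... | tri< x<y _ _ rewrite <ᵇ-true x<y | <ᵇ-false (ℕ.<⇒≤ x<y) =
      ∈-edges⁺ (cong₂ _∧_ (<ᵇ-true x<y) (trans (sym (∨-identityʳ (G x y))) adj))
    ... | tri> _ _ y<x rewrite <ᵇ-true y<x | <ᵇ-false (ℕ.<⇒≤ y<x) =
      ∈-edges⁺ (cong₂ _∧_ (<ᵇ-true y<x) adj)
    ... | tri≈ _ x≡y _ rewrite <ᵇ-false (ℕ.≤-reflexive x≡y) | <ᵇ-false (ℕ.≤-reflexive (sym x≡y)) with adj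
    ... | ()

    ∈-edges⁻ : ∀ {x y} → (x , y) ∈ edges → (toℕ x <ᵇ toℕ y) ∧ G x y ≡ true
    ∈-edges⁻ xy∈ =
      to T-≡ (proj₂ (∈-filter⁻ (T? ∘ _) {xs = cartesianProduct (allFin n) (allFin n)} xy∈))

    ∈-edges⇒adj : ∀ {x y} → (x , y) ∈ edges → Adj G x y ≡ true
    ∈-edges⇒adj {x} {y} xy∈ = cong (_∨ ((toℕ y <ᵇ toℕ x) ∧ G y x)) (∈-edges⁻ xy∈)

    ∈-edges⇒norm : ∀ {x y} → (x , y) ∈ edges → norm (x , y) ≡ (x , y)
    ∈-edges⇒norm {x} {y} xy∈ with toℕ x <ᵇ toℕ y | ∈-edges⁻ xy∈
    ... | true | _ = refl

    -- Trees grown leaf by leaf. Each edge may be stored in either orientation, which lets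
    -- `tree-path` turn edges around without touching the vertices.
    data Tree : ∀ k → List (Fin n) → Vec (Fin n × Fin n) k → Set where
      root : ∀ r → Tree 0 (r ∷ []) []
      grow : ∀ {k vs es x y o} → Tree k vs es → x ∈ vs → y ∉ vs → Adj G x y ≡ true →
             o ≡ (x , y) ⊎ o ≡ (y , x) → Tree (suc k) (y ∷ vs) (o ∷ es)

    tree-unique : ∀ {k vs es} → Tree k vs es → Unique vs
    tree-unique (root r) = [] ∷ []
    tree-unique (grow t x∈ y∉ adj o) = All.tabulate (λ { z∈ refl → y∉ z∈ }) ∷ tree-unique t

    tree-length : ∀ {k vs es} → Tree k vs es → length vs ≡ suc k
    tree-length (root r) = refl
    tree-length (grow t x∈ y∉ adj o) = cong suc (tree-length t)

    tree-adjacent : ∀ {k vs es} → Tree k vs es → ∀ e →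
      Adj G (proj₁ (lookup es e)) (proj₂ (lookup es e)) ≡ true
    tree-adjacent (grow t x∈ y∉ adj (inj₁ refl)) zero = adj
    tree-adjacent (grow {x = x} {y} t x∈ y∉ adj (inj₂ refl)) zero = trans (Adj-sym G y x) adj
    tree-adjacent (grow t x∈ y∉ adj o) (suc e) = tree-adjacent t e

    tree-ends : ∀ {k vs es} → Tree k vs es → ∀ e →
      proj₁ (lookup es e) ∈ vs × proj₂ (lookup es e) ∈ vs
    tree-ends (grow t x∈ y∉ adj (inj₁ refl)) zero = there x∈ , here refl
    tree-ends (grow t x∈ y∉ adj (inj₂ refl)) zero = here refl , there x∈
    tree-ends (grow t x∈ y∉ adj o) (suc e) = let p , q = tree-ends t e in there p , there q

    norm-oriented : ∀ {x y : Fin n} {o} → o ≡ (x , y) ⊎ o ≡ (y , x) → norm o ≡ norm (x , y)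
    norm-oriented         (inj₁ refl) = refl
    norm-oriented {x} {y} (inj₂ refl) = norm-swap y x

    -- A new edge ends in the new leaf, whereas all older edges have both ends among the older
    -- vertices.
    tree-norms-unique : ∀ {k vs es} → Tree k vs es → Unique (norms es)
    tree-norms-unique (root r) = []
    tree-norms-unique (grow {vs = vs} {es} {x} {y} t x∈ y∉ adj o) =
      All.tabulate fresh ∷ tree-norms-unique t
      where
      fresh : ∀ {q} → q ∈ norms es → norm _ ≢ q
      fresh q∈ eq with ∈-norms⁻ es q∈
      ... | e , refl with norm-≡ (trans (sym (norm-oriented o)) eq) | tree-ends t e
      ... | inj₁ (_ , y≡) | _ , q = y∉ (subst (_∈ vs) (sym y≡) q)
      ... | inj₂ (_ , y≡) | p , _ = y∉ (subst (_∈ vs) (sym y≡) p)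

    tree-norms⊆edges : ∀ {k vs es} → Tree k vs es → ∀ {q} → q ∈ norms es → q ∈ edges
    tree-norms⊆edges {es = es} t q∈ with ∈-norms⁻ es q∈
    ... | e , refl = adj⇒norm∈edges (tree-adjacent t e)

    drop-along : ∀ {k} → Point n → Vec (Fin n × Fin n) k → Fin k → ℚ
    drop-along a es e = a (proj₁ (lookup es e)) - a (proj₂ (lookup es e))

    update-old : ∀ {vs : List (Fin n)} {v} (a : Point n) f → v ∉ vs → ∀ {z} → z ∈ vs → updateAt a v f z ≡ a z
    update-old {v = v} a f v∉ {z} z∈ = updateAt-minimal z v a (λ { refl → v∉ z∈ })

    drop-along-update : ∀ {k vs es v} → Tree k vs es → v ∉ vs → ∀ a f e →
      drop-along (updateAt a v f) es e ≡ drop-along a es e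
    drop-along-update t v∉ a f e = let p , q = tree-ends t e in
      cong₂ _-_ (update-old a f v∉ p) (update-old a f v∉ q)

    -- The value at a new leaf is free, so it can be set to give the new edge any prescribed drop
    -- without disturbing the older ones.
    tree-potential : ∀ {k vs es} → Tree k vs es → (y : Fin k → ℚ) →
      ∃ λ a → ∀ e → drop-along a es e ≡ y e
    tree-potential (root r) y = (λ _ → 0ℚ) , λ ()
    tree-potential (grow {x = x} {v} t x∈ v∉ adj (inj₁ refl)) y with tree-potential t (y ∘ suc)
    ... | a , a-drop = updateAt a v f , λ
      { zero    → trans (cong₂ _-_ (update-old a f v∉ x∈) (updateAt-updates v a))
                        (solve 2 (λ x y → x :- (x :- y) := y) refl (a x) (y zero))
      ; (suc e) → trans (drop-along-update t v∉ a f e) (a-drop e) }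
      where
      f : ℚ → ℚ
      f = const (a x - y zero)
    tree-potential (grow {x = x} {v} t x∈ v∉ adj (inj₂ refl)) y with tree-potential t (y ∘ suc)
    ... | a , a-drop = updateAt a v f , λ
      { zero    → trans (cong₂ _-_ (updateAt-updates v a) (update-old a f v∉ x∈))
                        (solve 2 (λ x y → x :+ y :- x := y) refl (a x) (y zero))
      ; (suc e) → trans (drop-along-update t v∉ a f e) (a-drop e) }
      where
      f : ℚ → ℚ
      f = const (a x + y zero)

    -- Reorienting the tree edges along the path from u to v makes all coefficients 0 or 1.
    tree-path : ∀ {k vs es u v} → Tree k vs es → u ∈ vs → v ∈ vs →
      ∃₂ λ es′ c → Tree k vs es′ × norms es′ ≡ norms es ×
                   (∀ a → a u - a v ≡ cycleSum c (drop-along a es′))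
    tree-path (root r) (here refl) (here refl) = [] , [] , root r , refl , λ a → +-inverseʳ (a r)
    tree-path (grow {x = x} {y} {o} t x∈ y∉ adj or) (here refl) (here refl) with tree-path t x∈ x∈
    ... | es′ , c , t′ , eq , rel = o ∷ es′ , false ∷ c , grow t′ x∈ y∉ adj or , cong (norm o ∷_) eq ,
      λ a → trans (+-inverseʳ (a y)) (trans (sym (+-inverseʳ (a x))) (rel a))
    tree-path (grow {x = x} {y} {o} t x∈ y∉ adj or) (there u∈) (there v∈) with tree-path t u∈ v∈
    ... | es′ , c , t′ , eq , rel = o ∷ es′ , false ∷ c , grow t′ x∈ y∉ adj or , cong (norm o ∷_) eq , rel
    tree-path {v = v} (grow {x = x} {y} t x∈ y∉ adj or) (here refl) (there v∈) with tree-path t x∈ v∈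
    ... | es′ , c , t′ , eq , rel =
      (y , x) ∷ es′ , true ∷ c , grow t′ x∈ y∉ adj (inj₂ refl) ,
      cong₂ _∷_ (trans (norm-swap y x) (sym (norm-oriented or))) eq ,
      λ a → trans (solve 3 (λ x y v → y :- v := (y :- x) :+ (x :- v)) refl (a x) (a y) (a v))
                  (cong (a y - a x +_) (rel a))
    tree-path {u = u} (grow {x = x} {y} t x∈ y∉ adj or) (there u∈) (here refl) with tree-path t u∈ x∈
    ... | es′ , c , t′ , eq , rel =
      (x , y) ∷ es′ , true ∷ c , grow t′ x∈ y∉ adj (inj₁ refl) ,
      cong₂ _∷_ (sym (norm-oriented or)) eq ,
      λ a → trans (solve 3 (λ x y u → u :- y := (x :- y) :+ (u :- x)) refl (a x) (a y) (a u))
                  (cong (a x - a y +_) (rel a))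

    open DecMembership (Fin._≟_ {n}) using () renaming (_∈?_ to _∈ᵛ?_)
    open DecMembership (≡-dec (Fin._≟_ {n}) (Fin._≟_ {n})) using () renaming (_∈?_ to _∈ᵉ?_)

    exit-edge : ∀ {vs : List (Fin n)} {x y} → Reach G x y → x ∈ vs → y ∉ vs →
      ∃₂ λ x′ y′ → x′ ∈ vs × y′ ∉ vs × Adj G x′ y′ ≡ true
    exit-edge here x∈ y∉ = ⊥-elim (y∉ x∈)
    exit-edge {vs} (step {i} {j} adj r) x∈ y∉ with j ∈ᵛ? vs
    ... | yes j∈ = exit-edge r j∈ y∉
    ... | no j∉ = i , j , x∈ , j∉ , adj

    tree-exists : Connected G → Fin n → ∀ k → k ℕ.< n → ∃₂ (Tree k)
    tree-exists conn r zero    k<n = r ∷ [] , [] , root r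
    tree-exists conn r (suc k) k<n with tree-exists conn r k (ℕ.<-trans (ℕ.n<1+n k) k<n)
    ... | vs , es , t with Fin.any? (λ y → ¬? (y ∈ᵛ? vs))
    -- A tree on k + 1 vertices that misses none would give n ≤ k + 1, against the bound.
    ... | no all∈ = ⊥-elim (ℕ.<⇒≱ k<n (begin
      n                  ≡⟨ sym (length-tabulate {n = n} (λ i → i)) ⟩
      length (allFin n)  ≤⟨ length-≤-⊆ (Unique.allFin⁺ n)
                              (λ {y} _ → decidable-stable (y ∈ᵛ? vs) (λ y∉ → all∈ (y , y∉))) ⟩
      length vs          ≡⟨ tree-length t ⟩
      suc k              ∎))
      where open ℕ.≤-Reasoning
    ... | yes (y , y∉) with nonempty t
      where
      nonempty : ∀ {k vs es} → Tree k vs es → ∃ (_∈ vs)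
      nonempty (root r) = r , here refl
      nonempty (grow {y = y} _ _ _ _ _) = y , here refl
    ... | x , x∈ with exit-edge (conn x y) x∈ y∉
    ... | x′ , y′ , x′∈ , y′∉ , adj = y′ ∷ vs , (x′ , y′) ∷ es , grow t x′∈ y′∉ adj (inj₁ refl)

    tree-spans : ∀ {k vs es} → Tree k vs es → suc k ≡ n → ∀ y → y ∈ vs
    tree-spans {k} {vs} t k≡ y = decidable-stable (y ∈ᵛ? vs) λ y∉ → ℕ.<-irrefl refl (begin
      suc n              ≡⟨ cong suc (trans (sym k≡) (sym (tree-length t))) ⟩
      length (y ∷ vs)    ≤⟨ length-≤-⊆ (All.tabulate (λ { z∈ refl → y∉ z∈ }) ∷ tree-unique t) (λ {z} _ → ∈-allFin z) ⟩
      length (allFin n)  ≡⟨ length-tabulate {n = n} (λ i → i) ⟩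
      n                  ∎)
      where open ℕ.≤-Reasoning

    -- Two pigeonhole arguments: the k tree edges cannot exhaust k + 1 edges, and two further edges
    -- would make k + 2.
    extra-edge : ∀ {k vs es} → Tree k vs es → suc k ≡ edgeCount G →
      ∃ λ o → o ∈ edges × (∀ {p} → p ∈ edges → p ∈ o ∷ norms es)
    extra-edge {k} {vs} {es} t count with any? (λ p → ¬? (p ∈ᵉ? norms es)) edges
    ... | no all∈ = ⊥-elim (ℕ.<-irrefl refl (begin
      suc k              ≡⟨ count ⟩
      length edges       ≤⟨ length-≤-⊆ edges-unique (λ {p} p∈ → decidable-stable (p ∈ᵉ? norms es)
                              (λ p∉ → all∈ (lose p∈ p∉))) ⟩
      length (norms es)  ≡⟨ length-norms es ⟩
      k                  ∎))
      where open ℕ.≤-Reasoning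
    ... | yes some with find some
    ... | o , o∈ , o∉ = o , o∈ , λ {p} p∈ → decidable-stable (p ∈ᵉ? (o ∷ norms es)) λ p∉ →
      ℕ.<-irrefl refl (begin
        suc (suc k)                    ≡⟨ cong (2 ℕ.+_) (sym (length-norms es)) ⟩
        length (p ∷ o ∷ norms es)      ≤⟨ length-≤-⊆ (All.tabulate (λ { z∈ refl → p∉ z∈ }) ∷
                                            All.tabulate (λ { z∈ refl → o∉ z∈ }) ∷ tree-norms-unique t)
                                          (λ { (here refl) → p∈ ; (there (here refl)) → o∈
                                             ; (there (there q∈)) → tree-norms⊆edges t q∈ }) ⟩
        length edges                   ≡⟨ sym count ⟩
        suc k                          ∎)
      where open ℕ.≤-Reasoning

    unicyclic-presentation : ∀ {k} → suc k ≡ n → Fin n → Connected G → edgeCount G ≡ n →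
      ∃ λ (c : Vec Bool k) → Presentation G (true ∷ c)
    unicyclic-presentation {k} k≡ r conn count
      with tree-exists conn r k (ℕ.≤-reflexive k≡)
    ... | vs , es , t with extra-edge t (trans k≡ (sym count))
    ... | (u , v) , uv∈ , all with tree-path t (tree-spans t k≡ u) (tree-spans t k≡ v)
    ... | es′ , c , t′ , eq , rel = c , record
      { src         = src
      ; tgt         = tgt
      ; adjacent    = λ { zero → trans (Adj-sym G v u) (∈-edges⇒adj uv∈) ; (suc e) → tree-adjacent t′ e }
      ; cover       = λ i j adj → cover i j (all (adj⇒norm∈edges adj))
      ; potential   = potential
      ; circulation = λ a → trans (cong (a v - a u +_) (sym (rel a)))
          (solve 2 (λ u v → (v :- u) :+ (u :- v) := con 0ℚ) refl (a u) (a v))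
      }
      where
      src tgt : Fin (suc k) → Fin n
      -- The extra edge runs from `v` back to `u` and closes the tree path from `u` to `v`, so the
      -- cycle is traversed in one direction.
      src zero    = v
      src (suc e) = proj₁ (lookup es′ e)
      tgt zero    = u
      tgt (suc e) = proj₂ (lookup es′ e)
      cover : ∀ i j → norm (i , j) ∈ (u , v) ∷ norms es →
        ∃ λ e → (i ≡ src e × j ≡ tgt e) ⊎ (i ≡ tgt e × j ≡ src e)
      cover i j (here ≡uv) = zero , Sum.swap (norm-≡ (trans ≡uv (sym (∈-edges⇒norm uv∈))))
      cover i j (there ij∈) with ∈-norms⁻ es′ (subst (norm (i , j) ∈_) (sym eq) ij∈)
      ... | e , ≡e = suc e , norm-≡ ≡e
      potential : ∀ y → cycleSum (true ∷ c) y ≡ 0ℚ → ∃ λ a → ∀ e → a (src e) - a (tgt e) ≡ y e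
      -- The tree edges are solved freely; the value on the extra edge is then forced by the zero
      -- cycle sum.
      potential y sum with tree-potential t′ (y ∘ suc)
      ... | a , a-drop = a , λ
        { zero    → begin
            a v - a u                               ≡⟨ neg-flip (a u) (a v) ⟩
            - (a u - a v)                           ≡⟨ cong -_ (trans (rel a) (cycleSum-cong c a-drop)) ⟩
            - s                                     ≡⟨ solve 2 (λ x s → :- s := x :- (x :+ s)) refl (y zero) s ⟩
            y zero - (y zero + s)                   ≡⟨ cong (λ x → y zero - x) sum ⟩
            y zero - 0ℚ                             ≡⟨ solve 1 (λ x → x :- con 0ℚ := x) refl (y zero) ⟩
            y zero                                  ∎
        ; (suc e) → a-drop e }
        where
        open ≡-Reasoning
        s = cycleSum c (y ∘ suc)

  -- The graphs C(n,m)

  prefix : ∀ {N} → Fin (suc N) → Vec Bool N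
  prefix zero            = replicate _ false
  prefix {suc N} (suc i) = true ∷ prefix i

  trues-prefix : ∀ {N} (u : Fin (suc N)) → trues (prefix u) ≡ toℕ u
  trues-prefix {zero}  zero    = refl
  trues-prefix {suc N} zero    = trues-prefix {N} zero
  trues-prefix {suc N} (suc i) = cong suc (trues-prefix i)

  cycleSum-prefix : ∀ {N} (u : Fin (suc N)) (a : Point (suc N)) →
    a zero - a u ≡ cycleSum (prefix u) (λ e → a (inject₁ e) - a (suc e))
  cycleSum-prefix {zero}  zero    a = +-inverseʳ (a zero)
  cycleSum-prefix {suc N} zero    a =
    trans (+-inverseʳ (a zero)) (trans (sym (+-inverseʳ (a (suc zero)))) (cycleSum-prefix zero (a ∘ suc)))
  cycleSum-prefix {suc N} (suc i) a = trans
    (solve 3 (λ x y z → x :- z := (x :- y) :+ (y :- z)) refl (a zero) (a (suc zero)) (a (suc i)))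
    (cong (a zero - a (suc zero) +_) (cycleSum-prefix i (a ∘ suc)))

  pathPotential : ∀ {N} → (Fin N → ℚ) → Point (suc N)
  pathPotential y zero            = 0ℚ
  pathPotential {suc N} y (suc i) = pathPotential (y ∘ suc) i - y zero

  pathPotential-diff : ∀ {N} (y : Fin N → ℚ) e →
    pathPotential y (inject₁ e) - pathPotential y (suc e) ≡ y e
  pathPotential-diff y zero    = solve 1 (λ y → con 0ℚ :- (con 0ℚ :- y) := y) refl (y zero)
  pathPotential-diff y (suc e) = trans
    (solve 3 (λ p q y → (p :- y) :- (q :- y) := p :- q) refl
      (pathPotential (y ∘ suc) (inject₁ e)) (pathPotential (y ∘ suc) (suc e)) (y zero))
    (pathPotential-diff (y ∘ suc) e)

  ∨-true⁻ : ∀ {x y} → x ∨ y ≡ true → x ≡ true ⊎ y ≡ true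
  ∨-true⁻ {true}  h = inj₁ refl
  ∨-true⁻ {false} h = inj₂ h

  ∧-true⁻ : ∀ {x y} → x ∧ y ≡ true → x ≡ true × y ≡ true
  ∧-true⁻ {true} h = refl , h

  ≡ᵇ-true⁺ : ∀ {m n} → m ≡ n → (m ≡ᵇ n) ≡ true
  ≡ᵇ-true⁺ {m} {n} eq = to T-≡ (ℕ.≡⇒≡ᵇ m n eq)

  ≡ᵇ-true⁻ : ∀ {m n} → (m ≡ᵇ n) ≡ true → m ≡ n
  ≡ᵇ-true⁻ {m} {n} eq = ℕ.≡ᵇ⇒≡ m n (from T-≡ eq)

  -- Edge zero is the chord from `u` back to vertex zero, the others are the path edges; the cycle
  -- consists of the chord and the path edges up to `u`.
  Cnm-presentation : ∀ {N} m (u : Fin (suc N)) → toℕ u ≡ m ∸ 1 → 1 ℕ.< toℕ u →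
    Presentation (Cnm (suc N) m) (true ∷ prefix u)
  Cnm-presentation {N} m u u≡ 1<u = record
    { src         = src
    ; tgt         = tgt
    ; adjacent    = adjacent
    ; cover       = cover
    ; potential   = potential
    ; circulation = λ a → trans (cong (a u - a zero +_) (sym (cycleSum-prefix u a)))
        (solve 2 (λ x y → (x :- y) :+ (y :- x) := con 0ℚ) refl (a u) (a zero))
    }
    where
    G : Graph (suc N)
    G = Cnm (suc N) m
    src tgt : Fin (suc N) → Fin (suc N)
    src zero    = u
    src (suc e) = inject₁ e
    tgt zero    = zero
    tgt (suc e) = suc e
    lt⇒adj : ∀ {i j} → toℕ i ℕ.< toℕ j → G i j ≡ true → Adj G i j ≡ true
    lt⇒adj {i} {j} i<j g = cong (_∨ ((toℕ j <ᵇ toℕ i) ∧ G j i)) (cong₂ _∧_ (<ᵇ-true i<j) g)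
    adjacent : ∀ e → Adj G (src e) (tgt e) ≡ true
    adjacent zero = trans (Adj-sym G u zero) (lt⇒adj (ℕ.<-trans (s≤s z≤n) 1<u)
      (trans (cong ((1 ≡ᵇ toℕ u) ∨_) (cong₂ _∧_ (≡ᵇ-true⁺ u≡) (<ᵇ-true 1<u))) (∨-zeroʳ (1 ≡ᵇ toℕ u))))
    adjacent (suc e) = lt⇒adj {inject₁ e} {suc e} (s≤s (ℕ.≤-reflexive (Fin.toℕ-inject₁ e)))
      (cong (_∨ ((toℕ (inject₁ e) ≡ᵇ 0) ∧ ((suc (toℕ e) ≡ᵇ m ∸ 1) ∧ (1 <ᵇ suc (toℕ e)))))
            (≡ᵇ-true⁺ (cong suc (Fin.toℕ-inject₁ e))))
    covered : ∀ i j → G i j ≡ true → ∃ λ e → (i ≡ src e × j ≡ tgt e) ⊎ (i ≡ tgt e × j ≡ src e)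
    covered i j g with ∨-true⁻ {suc (toℕ i) ≡ᵇ toℕ j} g
    covered i (suc e) g | inj₁ consecutive = suc e , inj₁
      (Fin.toℕ-injective (trans (ℕ.suc-injective (≡ᵇ-true⁻ {suc (toℕ i)} consecutive)) (sym (Fin.toℕ-inject₁ e))) , refl)
    covered i j g | inj₂ chord with ∧-true⁻ {toℕ i ≡ᵇ 0} chord
    ... | i≡0 , rest = zero , inj₂
      (Fin.toℕ-injective (≡ᵇ-true⁻ {toℕ i} i≡0) ,
       Fin.toℕ-injective (trans (≡ᵇ-true⁻ {toℕ j} (proj₁ (∧-true⁻ {toℕ j ≡ᵇ m ∸ 1} rest))) (sym u≡)))
    cover : ∀ i j → Adj G i j ≡ true → ∃ λ e → (i ≡ src e × j ≡ tgt e) ⊎ (i ≡ tgt e × j ≡ src e)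
    cover i j adj with ∨-true⁻ {(toℕ i <ᵇ toℕ j) ∧ G i j} adj
    ... | inj₁ h = covered i j (proj₂ (∧-true⁻ {toℕ i <ᵇ toℕ j} h))
    ... | inj₂ h with covered j i (proj₂ (∧-true⁻ {toℕ j <ᵇ toℕ i} h))
    ... | e , which = e , Sum.swap (Sum.map swap swap which)
    potential : ∀ y → cycleSum (true ∷ prefix u) y ≡ 0ℚ → ∃ λ a → ∀ e → a (src e) - a (tgt e) ≡ y e
    potential y sum = a , λ
      { zero    → begin
          a u - a zero          ≡⟨ neg-flip (a zero) (a u) ⟩
          - (a zero - a u)      ≡⟨ cong -_ (trans (cycleSum-prefix u a)
                                     (cycleSum-cong (prefix u) (pathPotential-diff (y ∘ suc)))) ⟩
          - s                   ≡⟨ solve 2 (λ x s → :- s := x :- (x :+ s)) refl (y zero) s ⟩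
          y zero - (y zero + s) ≡⟨ cong (λ x → y zero - x) sum ⟩
          y zero - 0ℚ           ≡⟨ solve 1 (λ x → x :- con 0ℚ := x) refl (y zero) ⟩
          y zero                ∎
      ; (suc e) → pathPotential-diff (y ∘ suc) e }
      where
      open ≡-Reasoning
      s = cycleSum (prefix u) (y ∘ suc)
      a = pathPotential (y ∘ suc)

  -- The cycle has length toℕ u + 1 = 2k + 1, so its words carry one null, and `f` counts the
  -- pendant path edges.
  cycleCount≤facets : ∀ {N k₂} m f k (u : Fin (suc N)) → toℕ u ≡ m ∸ 1 → 1 ℕ.< toℕ u →
    toℕ u ≡ double k → f ℕ.+ suc (toℕ u) ≡ suc N → FacetCount (Cnm (suc N) m) k₂ →
    2 ℕ.^ f ℕ.* cycleCount k 1 ℕ.≤ k₂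
  cycleCount≤facets {N} {k₂} m f k u u≡ 1<u u≡2k f+u count =
    subst (ℕ._≤ k₂) (trans (length-words-cycleCount c k 1 size) (cong (λ f → 2 ℕ.^ f ℕ.* cycleCount k 1) falses≡))
      (Facets.words≤facets (Cnm-presentation m u u≡ 1<u) k 1 (inj₂ refl) zero count)
    where
    c = true ∷ prefix u
    size : k ℕ.+ k ℕ.+ 1 ≡ trues c
    size = trans (ℕ.+-comm (k ℕ.+ k) 1)
      (cong suc (trans (sym (double≡+ k)) (trans (sym u≡2k) (sym (trues-prefix u)))))
    falses≡ : falses c ≡ f
    falses≡ = ℕ.+-cancelʳ-≡ (suc (toℕ u)) (falses c) f
      (trans (cong (λ t → falses c ℕ.+ suc t) (sym (trues-prefix u))) (trans (trues+falses c) (sym f+u)))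

  maxCount≤odd : ∀ {n k₂} (P : Parity n) → 3 ℕ.≤ n → n % 2 ≡ 1 →
    FacetCount (Cnm n n) k₂ → maxCount P ℕ.≤ k₂
  maxCount≤odd (even k) _ ≡1 with trans (sym (double%2 k)) ≡1
  ... | ()
  maxCount≤odd {k₂ = k₂} (odd k) (s≤s 2≤) _ count =
    subst (ℕ._≤ k₂) (ℕ.*-identityˡ (cycleCount k 1))
      (cycleCount≤facets (suc (double k)) 0 k (fromℕ (double k)) u≡ (subst (1 ℕ.<_) (sym u≡) 2≤) u≡ (cong suc u≡) count)
    where
    u≡ : toℕ (fromℕ (double k)) ≡ double k
    u≡ = Fin.toℕ-fromℕ (double k)

  maxCount≤even : ∀ {n k₂} (P : Parity n) → 3 ℕ.≤ n → n % 2 ≡ 0 →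
    FacetCount (Cnm n (n ∸ 1)) k₂ → maxCount P ℕ.≤ k₂
  maxCount≤even (odd k) _ ≡0 with trans (sym (suc-double%2 k)) ≡0
  ... | ()
  maxCount≤even (even (suc zero)) (s≤s (s≤s ())) _ count
  maxCount≤even (even (suc (suc k))) _ _ count =
    cycleCount≤facets (suc (double (suc k))) 1 (suc k) u u≡ (subst (1 ℕ.<_) (sym u≡) (s≤s (s≤s z≤n))) u≡ (cong (2 ℕ.+_) u≡) count
    where
    -- With n = 2k + 4, this is the last vertex but one: the chord closes a cycle of length 2k + 3
    -- and one pendant edge remains, hence the exponent 1.
    u = inject₁ (fromℕ (double (suc k)))
    u≡ : toℕ u ≡ double (suc k)
    u≡ = trans (Fin.toℕ-inject₁ (fromℕ (double (suc k)))) (Fin.toℕ-fromℕ (double (suc k)))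

open Counting using (parity; maxCount)
open Polytopes using (unicyclic-presentation; facets≤maxCount; maxCount≤odd; maxCount≤even)
open import Data.Fin using (zero)
open import Data.Nat using (ℕ; suc; _≤_; _∸_; _%_; s≤s; z≤n)
open import Data.Nat.Properties using (≤-trans)
open import Data.Product using (_×_; _,_)
open import Relation.Binary.PropositionalEquality using (_≡_; refl)

theorem3p2 : (n : ℕ) → 3 ≤ n → (G : Graph n) → Connected G → edgeCount G ≡ n →
    (k₁ k₂ : ℕ) → FacetCount G k₁ →
    ((n % 2 ≡ 1) → FacetCount (Cnm n n) k₂ → k₁ ≤ k₂) ×
    ((n % 2 ≡ 0) → FacetCount (Cnm n (n ∸ 1)) k₂ → k₁ ≤ k₂)
theorem3p2 n@(suc N) 3≤n G conn edges≡n k₁ k₂ count =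
  (λ odd-n countC → ≤-trans upper (maxCount≤odd (parity n) 3≤n odd-n countC)) ,
  (λ even-n countC → ≤-trans upper (maxCount≤even (parity n) 3≤n even-n countC))
  where
  upper : k₁ ≤ maxCount (parity n)
  -- The root of the tree is arbitrary. The cycle contains at least the extra edge, whence the bound
  -- `s≤s z≤n`.
  upper = let c , P = unicyclic-presentation G refl zero conn edges≡n
          in facets≤maxCount P (s≤s z≤n) count
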